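{- Let $\varphi,\psi\in\mathcal{F}^{\ast}$. Then for every $n\ge1$, \[\Lambda_n(1,\varphi\,|\,1,\psi)=\sum_{k=1}^n\Big(A^{\psi}_{n,k}(0)\sum_{j=1}^kA^{\varphi}_{j,1}(0)A_{k,j}\Big).\]
   Context: $\mathbb{K}$ is a field of characteristic zero, $\mathcal{F}=\mathbb{K}[[x]]$ with derivation $D$, $\mathcal{F}^{\ast}$ the set of series $g$ with $g(0)=0$, $D(g)(0)\ne0$. Partial Bell polynomials: $B_{0,0}=1$, $B_{n,0}=0$ ($n\ge1$), $B_{n,k}=0$ ($k>n$), and for $1\le k\le n$, $B_{n,k}=\sum\frac{n!}{\prod_ir_i!(i!)^{r_i}}\prod_iX_i^{r_i}$ over non-negative integers with $\sum r_i=k$, $\sum ir_i=n$. $A_{n,k}\in\mathbb{K}[X_1^{ -1},X_1,X_2,\ldots]$ is the unique lower triangular family with $A_{0,0}=1$, $A_{n,0}=0$ ($n\ge1$) and $\sum_{j=k}^nA_{n,j}B_{j,k}=\delta_{nk}$. For a polynomial $P$ and function $\varphi$, $P^{\varphi}(0)$ is $P$ with each $X_j$ replaced by $D^j(\varphi)(0)$. Reciprocal polynomials: $\widehat R_m:=\sum_{i=0}^m(-1)^ii!X_0^{ -(i+1)}B_{m,i}$. For $a\in\mathcal{F}_1$ (nonzero constant term) with $a_j=D^j(a)(0)$ and $\varphi\in\mathcal{F}^{\ast}$ define $\Gamma^{(1)}_n(a,\varphi):=\sum_{k=1}^n\big(\sum_{j=k}^n\binom nj a_{n-j}B^{\varphi}_{j,k}(0)\big)X_k$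 and $\bar\Gamma^{(1)}_n(a,\varphi):=\sum_{k=0}^n\big(\sum_{j=k}^n\binom jk\widehat R_{j-k}(a_0,\ldots,a_{j-k})A^{\varphi}_{n,j}(0)\big)X_k$. The generalized Lagrange inversion polynomial for $a=b=1$ (constant function) is $\Lambda_n(1,\varphi\,|\,1,\psi):=\bar\Gamma^{(1)}_n(1,\psi)\circ A_{\bullet,1}\circ\Gamma^{(1)}_{\bullet}(1,\varphi)$, i.e. in $\bar\Gamma^{(1)}_n(1,\psi)$ each $X_j$ is replaced by $A_{j,1}(\Gamma^{(1)}_1(1,\varphi),\ldots,\Gamma^{(1)}_j(1,\varphi))$, with $A_{0,1}=0$. -}

module Defs where

open import Level using (Level; _⊔_) renaming (suc to lsuc)
open import Data.Nat as ℕ using (ℕ; zero; suc; _∸_; NonZero)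
open import Data.Nat.Properties using (_≟_; m*n≢0; m^n≢0; _!≢0)
open import Data.Nat.Combinatorics using (_C_)
open import Data.Bool using (Bool; true; false; if_then_else_; _∧_)
open import Data.List using (List; []; _∷_; map; concatMap; upTo; foldr)
open import Data.Vec using (Vec; []; _∷_)
open import Relation.Nullary using (¬_; does)
open import Relation.Binary.PropositionalEquality using (_≡_)
open import Algebra.Bundles using (CommutativeRing)
open import Algebra.Morphism.Structures using (module RingMorphisms)

-- Generic operations in a commutative ring S: evaluation of the
-- polynomials of the paper at given values of the variables.

module Ops {c ℓ : Level} (S : CommutativeRing c ℓ) where
  open CommutativeRing S

  fromℕ : ℕ → Carrier
  fromℕ zero    = 0#
  fromℕ (suc n) = 1# + fromℕ n

  pow : Carrier → ℕ → Carrier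
  pow x zero    = 1#
  pow x (suc n) = x * pow x n

  -- sumFT a b f  =  Σ_{i=a}^{b} f i   (empty, i.e. 0#, if b < a)
  sumFT : ℕ → ℕ → (ℕ → Carrier) → Carrier
  sumFT a b f = foldr (λ i s → f (a ℕ.+ i) + s) 0# (upTo (suc b ∸ a))

  sumList : List Carrier → Carrier
  sumList = foldr _+_ 0#

  -- Partial Bell polynomials B_{n,k}, by the explicit formula
  --   B_{n,k} = Σ n! / (Π_i r_i! (i!)^{r_i}) Π_i X_i^{r_i}
  -- over (r_1,…,r_n) ∈ ℕ^n with Σ r_i = k, Σ i r_i = n.
  -- (Every admissible tuple has r_i ≤ n and r_i = 0 for i > n, so
  --  enumerating r ∈ {0..n}^n is exhaustive.)  The formula yields
  --  B_{0,0} = 1, B_{n,0} = 0 (n ≥ 1), B_{n,k} = 0 (k > n), as in the paper.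

  vecs : ℕ → (len : ℕ) → List (Vec ℕ len)
  vecs m zero      = [] ∷ []
  vecs m (suc len) = concatMap (λ v → map (λ e → e ∷ v) (upTo (suc m))) (vecs m len)

  -- in the following, the entry at position p of a vector is r_{i+p}
  Σr : ∀ {len} → Vec ℕ len → ℕ
  Σr []       = 0
  Σr (r ∷ rs) = r ℕ.+ Σr rs

  Σir : ∀ {len} → ℕ → Vec ℕ len → ℕ
  Σir i []       = 0
  Σir i (r ∷ rs) = i ℕ.* r ℕ.+ Σir (suc i) rs

  den : ∀ {len} → ℕ → Vec ℕ len → ℕ
  den i []       = 1
  den i (r ∷ rs) = (r ℕ.!) ℕ.* ((i ℕ.!) ℕ.^ r) ℕ.* den (suc i) rs

  den-nz : ∀ {len} (i : ℕ) (r : Vec ℕ len) → NonZero (den i r)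
  den-nz i []       = _
  den-nz i (r ∷ rs) =
    m*n≢0 ((r ℕ.!) ℕ.* ((i ℕ.!) ℕ.^ r)) (den (suc i) rs)
      {{m*n≢0 (r ℕ.!) ((i ℕ.!) ℕ.^ r) {{r !≢0}} {{m^n≢0 (i ℕ.!) r {{i !≢0}}}}}}
      {{den-nz (suc i) rs}}

  mono : ∀ {len} → (ℕ → Carrier) → ℕ → Vec ℕ len → Carrier
  mono x i []       = 1#
  mono x i (r ∷ rs) = pow (x i) r * mono x (suc i) rs

  bellTerm : (ℕ → Carrier) → (n k : ℕ) → Vec ℕ n → Carrier
  bellTerm x n k r =
    if does (Σr r ≟ k) ∧ does (Σir 1 r ≟ n)
    then fromℕ (ℕ._/_ (n ℕ.!) (den 1 r) {{den-nz 1 r}}) * mono x 1 r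
    else 0#

  B : ℕ → ℕ → (ℕ → Carrier) → Carrier
  B n k x = sumList (map (bellTerm x n k) (vecs n n))

  -- The family A_{n,k} ∈ K[X_1^{-1}, X_1, X_2, …], evaluated at the
  -- values x (with u playing the role of X_1^{-1}, i.e. x 1 * u ≈ 1#).
  -- It is the unique lower triangular family with A_{0,0}=1,
  -- A_{n,0}=0 (n≥1) and Σ_{j=k}^n A_{n,j} B_{j,k} = δ_{nk}; we compute
  -- it by solving this triangular system:
  --   A_{n,n} = X_1^{-n},
  --   A_{n,k} = - X_1^{-k} Σ_{j=k+1}^n A_{n,j} B_{j,k}   (1 ≤ k < n).

  -- rowUpTo x u n g k = A_{n,k} for all k with n ∸ g ≤ k (and k ≥ 1)
  rowUpTo : (ℕ → Carrier) → Carrier → ℕ → ℕ → ℕ → Carrier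
  rowUpTo x u n zero    k = if does (k ≟ n) then pow u n else 0#
  rowUpTo x u n (suc g) k =
    if does (k ≟ n ∸ suc g)
    then - (pow u k * sumFT (suc k) n (λ j → rowUpTo x u n g j * B j k x))
    else rowUpTo x u n g k

  A : ℕ → ℕ → (ℕ → Carrier) → Carrier → Carrier
  A n zero    x u = if does (n ≟ 0) then 1# else 0#
  A n (suc k) x u = rowUpTo x u n n (suc k)

  Rhat : ℕ → (ℕ → Carrier) → Carrier → Carrier
  Rhat m a a0inv =
    sumFT 0 m (λ i → pow (- 1#) i * fromℕ (i ℕ.!) * pow a0inv (suc i) * B m i a)

record Field (c ℓ : Level) : Set (lsuc (c ⊔ ℓ)) where
  field
    commutativeRing : CommutativeRing c ℓ
  open CommutativeRing commutativeRing public
  field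
    1≉0     : ¬ (1# ≈ 0#)
    inv     : (x : Carrier) → ¬ (x ≈ 0#) → Carrier
    inverse : ∀ x (p : ¬ (x ≈ 0#)) → x * inv x p ≈ 1#

module FieldOps {c ℓ : Level} (K : Field c ℓ) where
  open Field K
  open Ops commutativeRing public

  CharZero : Set ℓ
  CharZero = ∀ (n : ℕ) → fromℕ n ≈ 0# → n ≡ 0

  -- Formal power series K[[x]] as coefficient sequences, derivation D,
  -- and the value D^j(f)(0).
  Series : Set c
  Series = ℕ → Carrier

  D : Series → Series
  D f n = fromℕ (suc n) * f (suc n)

  Dpow : ℕ → Series → Series
  Dpow zero    f = f
  Dpow (suc j) f = D (Dpow j f)

  d : Series → ℕ → Carrier
  d f j = Dpow j f 0

  record InFstar (g : Series) : Set ℓ where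
    field
      val0  : d g 0 ≈ 0#
      der0  : ¬ (d g 1 ≈ 0#)

  oneS : Series
  oneS zero    = 1#
  oneS (suc n) = 0#

  Aφ : (φ : Series) → InFstar φ → ℕ → ℕ → Carrier
  Aφ φ hφ n k = A n k (d φ) (inv (d φ 1) (InFstar.der0 hφ))

  Bφ : Series → ℕ → ℕ → Carrier
  Bφ φ n k = B n k (d φ)

  -- coefficient of X_k in Γ^{(1)}_n(a,φ)   (1 ≤ k ≤ n)
  γcoef : Series → Series → ℕ → ℕ → Carrier
  γcoef a φ n k = sumFT k n (λ j → fromℕ (n C j) * d a (n ∸ j) * Bφ φ j k)

  -- coefficient of X_k in Γ̄^{(1)}_n(a,ψ)   (0 ≤ k ≤ n);  a0inv = a_0^{-1}
  γbarcoef : Series → Carrier → (ψ : Series) → InFstar ψ → ℕ → ℕ → Carrier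
  γbarcoef a a0inv ψ hψ n k =
    sumFT k n (λ j → fromℕ (j C k) * Rhat (j ∸ k) (λ i → d a i) a0inv * Aφ ψ hψ n j)

-- The polynomials Γ, Γ̄, Λ evaluated in a commutative K-algebra R
-- (K → R a ring homomorphism ι) at values X_1, X_2, … ∈ R with
-- X_1 invertible, u = X_1^{-1}.

module AlgOps {c ℓ c' ℓ' : Level} (K : Field c ℓ) (R : CommutativeRing c' ℓ')
              (ι : Field.Carrier K → CommutativeRing.Carrier R) where
  private module K = Field K
  open FieldOps K using (Series; InFstar; γcoef; γbarcoef; Aφ; d; oneS)
  open CommutativeRing R
  open Ops R

  Γ : Series → Series → (ℕ → Carrier) → ℕ → Carrier
  Γ a φ X n = sumFT 1 n (λ k → ι (γcoef a φ n k) * X k)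

  Γbar : Series → K.Carrier → (ψ : Series) → InFstar ψ → (ℕ → Carrier) → ℕ → Carrier
  Γbar a a0inv ψ hψ Y n = sumFT 0 n (λ k → ι (γbarcoef a a0inv ψ hψ n k) * Y k)

  -- inverse of Γ_1(1,φ) = (D φ(0)) X_1, namely (D φ(0))^{-1} X_1^{-1}
  Γ₁inv : (φ : Series) → InFstar φ → Carrier → Carrier
  Γ₁inv φ hφ u = ι (K.inv (d φ 1) (InFstar.der0 hφ)) * u

  Λ : (φ : Series) → InFstar φ → (ψ : Series) → InFstar ψ →
      (X : ℕ → Carrier) → (u : Carrier) → ℕ → Carrier
  Λ φ hφ ψ hψ X u n =
    Γbar oneS (K.inv K.1# K.1≉0) ψ hψ
      (λ j → A j 1 (Γ oneS φ X) (Γ₁inv φ hφ u)) n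

  RHS : (φ : Series) → InFstar φ → (ψ : Series) → InFstar ψ →
        (X : ℕ → Carrier) → (u : Carrier) → ℕ → Carrier
  RHS φ hφ ψ hψ X u n =
    sumFT 1 n (λ k → ι (Aφ ψ hψ n k) *
      sumFT 1 k (λ j → ι (Aφ φ hφ j 1) * A k j X u))

IsRingHom : ∀ {c ℓ c' ℓ'} (K : Field c ℓ) (R : CommutativeRing c' ℓ') →
            (Field.Carrier K → CommutativeRing.Carrier R) → Set _
IsRingHom K R ι =
  RingMorphisms.IsRingHomomorphism (Field.rawRing K) (CommutativeRing.rawRing R) ι

{-# OPTIONS --safe #-}
module Submission where

-- With x̂(t) = Σ_{i≥1} x_i t^i / i!, the explicit formula for the Bell polynomials says
-- B_{n,k}(x) = n!/k! [t^n] x̂^k: the sum over exponent vectors is the coefficient of s^k in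
-- Π_i exp(s x_i t^i / i!) = exp(s x̂).  Since (f ∘ φ)^k = f^k ∘ φ, the Bell matrices satisfy
-- B(y) = B(φ) B(X) for ŷ = X̂ ∘ φ̂, i.e. for y = Γ(1, φ).  Left inverses of triangular matrices
-- are unique, so A(y) = A(X) A(φ), and the first column of this identity is what Λ requires,
-- because the coefficients of Γ̄(1, ψ) are just A^ψ_{n,k}.

open import Defs
open import Level using (Level)
open import Data.Nat as ℕ using (ℕ; zero; suc; _∸_; _≤_; _<_; _≥_; z≤n; s≤s; _!)
import Data.Nat.Properties as ℕ
open import Data.Nat.Combinatorics using (_C_; nCn≡1; k![n∸k]!∣n!)
open import Data.Nat.Divisibility using (_∣_; *-monoʳ-∣; *-pres-∣; ∣-trans; ∣-refl; ∣-reflexive; module ∣-Reasoning)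
open import Data.Nat.DivMod using (m/n*n≡m)
import Data.Nat.Solver as ℕSolver
open import Data.Bool using (true; false; T; if_then_else_)
open import Data.List using (List; []; _∷_; map; concatMap; upTo; applyUpTo; foldr; _++_)
open import Data.List.Properties using (map-∘)
open import Data.Product using (_,_)
open import Data.Sum using (inj₁; inj₂)
open import Data.Vec using (Vec; []; _∷_)
open import Function using (_∘_; id)
open import Relation.Nullary using (does; yes; no)
open import Relation.Nullary.Decidable using (dec-true; dec-false)
open import Relation.Binary.Definitions using (tri<; tri≈; tri>)
open import Relation.Binary.PropositionalEquality as ≡ using (_≡_; _≢_)
open import Algebra.Bundles using (CommutativeRing)
open import Algebra.Morphism.Structures using (module RingMorphisms)
import Algebra.Properties.CommutativeSemigroup as CSg
import Algebra.Properties.Group as GroupProperties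
import Algebra.Properties.Ring as RingProperties
import Algebra.Solver.Ring.NaturalCoefficients.Default as NatSolver
import Relation.Binary.Reasoning.Setoid as SetoidReasoning

-- The variables take values in an arbitrary commutative `K`-algebra `R`, where nonzero factors
-- cannot be cancelled. What is available is division by factorials, carried along as a function
-- `ifac` with `n! * ifac n ≈ 1#`. The theory of Bell polynomials is developed over any ring with
-- such a function and used over `K` and over `R`; the exponential series is even taken over a ring
-- of truncated series in `t`. Two features of the explicit formula for B_{n,k} shape the work. Its
-- coefficients are quotients in ℕ, which become quotients in the ring only once the denominator is
-- known to divide n!. Its sum runs over a finite box of exponent vectors with two side conditions;
-- these turn into the choice of one coefficient s^k t^n of a product, and working modulo t^(n+1)
-- makes the finite box exact. Left inverses are unique because the diagonal of a Bell matrix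
-- consists of powers of x_1, a unit in every case: `X 1` by assumption, the derivative of φ at 0
-- because it is nonzero in `K`, and the first value of Γ(1, φ) as their product.

-- Finite sums, numerals and powers in a commutative ring.

module Sums {c ℓ : Level} (Q : CommutativeRing c ℓ) where
  open CommutativeRing Q
  open Ops Q
  open SetoidReasoning setoid
  private module + = CSg +-commutativeSemigroup

  -- Shifting the summand instead of the range keeps inductions structural; `sumFT-sum` translates
  -- from the folds over `upTo`.
  sum : ℕ → (ℕ → Carrier) → Carrier
  sum zero    f = 0#
  sum (suc n) f = f 0 + sum n (f ∘ suc)

  sum-cong : ∀ n {f g : ℕ → Carrier} → (∀ i → i < n → f i ≈ g i) → sum n f ≈ sum n g
  sum-cong zero    e = refl
  sum-cong (suc n) e = +-cong (e 0 (s≤s z≤n)) (sum-cong n λ i i<n → e (suc i) (s≤s i<n))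

  sum-zero : ∀ n {f : ℕ → Carrier} → (∀ i → i < n → f i ≈ 0#) → sum n f ≈ 0#
  sum-zero zero    e = refl
  sum-zero (suc n) e =
    trans (+-cong (e 0 (s≤s z≤n)) (sum-zero n λ i i<n → e (suc i) (s≤s i<n))) (+-identityˡ 0#)

  sum-+ : ∀ n (f g : ℕ → Carrier) → sum n (λ i → f i + g i) ≈ sum n f + sum n g
  sum-+ zero    f g = sym (+-identityˡ 0#)
  sum-+ (suc n) f g = trans (+-congˡ (sum-+ n (f ∘ suc) (g ∘ suc))) (+.interchange _ _ _ _)

  sum-*ˡ : ∀ n a (f : ℕ → Carrier) → a * sum n f ≈ sum n (λ i → a * f i)
  sum-*ˡ zero    a f = zeroʳ a
  sum-*ˡ (suc n) a f = trans (distribˡ _ _ _) (+-congˡ (sum-*ˡ n a (f ∘ suc)))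

  sum-*ʳ : ∀ n a (f : ℕ → Carrier) → sum n f * a ≈ sum n (λ i → f i * a)
  sum-*ʳ zero    a f = zeroˡ a
  sum-*ʳ (suc n) a f = trans (distribʳ _ _ _) (+-congˡ (sum-*ʳ n a (f ∘ suc)))

  sum-swap : ∀ m n (f : ℕ → ℕ → Carrier) →
    sum m (λ i → sum n (f i)) ≈ sum n (λ j → sum m (λ i → f i j))
  sum-swap zero    n f = sym (sum-zero n λ _ _ → refl)
  sum-swap (suc m) n f =
    trans (+-congˡ (sum-swap m n (f ∘ suc))) (sym (sum-+ n (f 0) (λ j → sum m (λ i → f (suc i) j))))

  sum-last : ∀ n (f : ℕ → Carrier) → sum (suc n) f ≈ sum n f + f n
  sum-last zero    f = +-comm _ _
  sum-last (suc n) f = trans (+-congˡ (sum-last n (f ∘ suc))) (sym (+-assoc _ _ _))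

  sum-extend : ∀ m n {f : ℕ → Carrier} → m ≤ n → (∀ i → m ≤ i → f i ≈ 0#) → sum m f ≈ sum n f
  sum-extend zero    n       z≤n       e = sym (sum-zero n λ i _ → e i z≤n)
  sum-extend (suc m) (suc n) (s≤s m≤n) e =
    +-congˡ (sum-extend m n m≤n λ i m≤i → e (suc i) (s≤s m≤i))

  -- Truncated subtraction is harmless: for `m < a` the left sum is empty and every term on the
  -- right is one of the vanishing ones.
  sum-drop : ∀ a m (f : ℕ → Carrier) → (∀ i → i < a → f i ≈ 0#) →
    sum (m ∸ a) (λ i → f (a ℕ.+ i)) ≈ sum m f
  sum-drop zero    m       f e = refl
  sum-drop (suc a) zero    f e = refl
  sum-drop (suc a) (suc m) f e = begin
    sum (m ∸ a) (λ i → f (suc a ℕ.+ i)) ≈⟨ sum-drop a m (f ∘ suc) (λ i i<a → e (suc i) (s≤s i<a)) ⟩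
    sum m (f ∘ suc)                     ≈⟨ +-identityˡ _ ⟨
    0# + sum m (f ∘ suc)                ≈⟨ +-congʳ (e 0 (s≤s z≤n)) ⟨
    sum (suc m) f                       ∎

  foldr-applyUpTo : ∀ n (f : ℕ → Carrier) (h : ℕ → ℕ) →
    foldr (λ i s → f i + s) 0# (applyUpTo h n) ≡ sum n (f ∘ h)
  foldr-applyUpTo zero    f h = ≡.refl
  foldr-applyUpTo (suc n) f h = ≡.cong (f (h 0) +_) (foldr-applyUpTo n f (h ∘ suc))

  sumFT-sum : ∀ a b (f : ℕ → Carrier) → sumFT a b f ≈ sum (suc b ∸ a) (λ i → f (a ℕ.+ i))
  sumFT-sum a b f = reflexive (foldr-applyUpTo (suc b ∸ a) (λ i → f (a ℕ.+ i)) id)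

  -- Lets a triangular sum be treated as a sum over a full row or column.
  sumFT-full : ∀ a b (f : ℕ → Carrier) → (∀ i → i < a → f i ≈ 0#) → sumFT a b f ≈ sum (suc b) f
  sumFT-full a b f e = trans (sumFT-sum a b f) (sum-drop a (suc b) f e)

  sumFT-cong : ∀ a b {f g : ℕ → Carrier} →
    (∀ i → a ≤ i → i ≤ b → f i ≈ g i) → sumFT a b f ≈ sumFT a b g
  sumFT-cong a b {f} {g} e = begin
    sumFT a b f                            ≈⟨ sumFT-sum a b f ⟩
    sum (suc b ∸ a) (λ i → f (a ℕ.+ i))
      ≈⟨ sum-cong (suc b ∸ a) (λ i i< → e (a ℕ.+ i) (ℕ.m≤m+n a i) (ℕ.≤-pred (below a (suc b) i<))) ⟩
    sum (suc b ∸ a) (λ i → g (a ℕ.+ i))    ≈⟨ sumFT-sum a b g ⟨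
    sumFT a b g                            ∎
    where
    below : ∀ a m {i} → i < m ∸ a → a ℕ.+ i < m
    below zero    m       p = p
    below (suc a) (suc m) p = s≤s (below a m p)

  sumFT-head : ∀ {k n} (f : ℕ → Carrier) → k ≤ n → sumFT k n f ≈ f k + sumFT (suc k) n f
  sumFT-head {k} {n} f k≤n = begin
    sumFT k n f                                          ≈⟨ sumFT-sum k n f ⟩
    sum (suc n ∸ k) (λ i → f (k ℕ.+ i))
      ≡⟨ ≡.cong (λ m → sum m (λ i → f (k ℕ.+ i))) (ℕ.+-∸-assoc 1 k≤n) ⟩
    f (k ℕ.+ 0) + sum (n ∸ k) (λ i → f (k ℕ.+ suc i))    ≈⟨ +-cong (reflexive (≡.cong f (ℕ.+-identityʳ k)))
                                                              (sum-cong (n ∸ k) λ i _ → reflexive (≡.cong f (ℕ.+-suc k i))) ⟩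
    f k + sum (n ∸ k) (λ i → f (suc k ℕ.+ i))            ≈⟨ +-congˡ (sumFT-sum (suc k) n f) ⟨
    f k + sumFT (suc k) n f                              ∎

  sumFT-zero : ∀ a b {f : ℕ → Carrier} → (∀ i → a ≤ i → i ≤ b → f i ≈ 0#) → sumFT a b f ≈ 0#
  sumFT-zero a b e = trans (sumFT-cong a b e)
    (trans (sumFT-sum a b (λ _ → 0#)) (sum-zero (suc b ∸ a) λ _ _ → refl))

  -- Associativity (aM)b = a(Mb) for a row, a square matrix and a column of size `N`.
  row-matrix-column : ∀ N (a : ℕ → Carrier) (M : ℕ → ℕ → Carrier) (b : ℕ → Carrier) →
    sum N (λ k → sum N (λ j → a j * M j k) * b k) ≈ sum N (λ j → a j * sum N (λ k → M j k * b k))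
  row-matrix-column N a M b = begin
    sum N (λ k → sum N (λ j → a j * M j k) * b k)
      ≈⟨ sum-cong N (λ k _ → sum-*ʳ N (b k) (λ j → a j * M j k)) ⟩
    sum N (λ k → sum N (λ j → a j * M j k * b k))   ≈⟨ sum-swap N N (λ k j → a j * M j k * b k) ⟩
    sum N (λ j → sum N (λ k → a j * M j k * b k))
      ≈⟨ sum-cong N (λ j _ → trans (sum-cong N λ k _ → *-assoc (a j) (M j k) (b k))
                                                         (sym (sum-*ˡ N (a j) (λ k → M j k * b k)))) ⟩
    sum N (λ j → a j * sum N (λ k → M j k * b k))   ∎

  sumList-map-upTo : ∀ n (f : ℕ → Carrier) → sumList (map f (upTo n)) ≡ sum n f
  sumList-map-upTo n f = go n id
    where
    go : ∀ n (h : ℕ → ℕ) → sumList (map f (applyUpTo h n)) ≡ sum n (f ∘ h)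
    go zero    h = ≡.refl
    go (suc n) h = ≡.cong (f (h 0) +_) (go n (h ∘ suc))

  module _ {a} {V : Set a} where

    sumList-map-cong : ∀ (xs : List V) {f g : V → Carrier} → (∀ v → f v ≈ g v) →
      sumList (map f xs) ≈ sumList (map g xs)
    sumList-map-cong []       e = refl
    sumList-map-cong (x ∷ xs) e = +-cong (e x) (sumList-map-cong xs e)

    sumList-map-*ˡ : ∀ (xs : List V) b (f : V → Carrier) →
      b * sumList (map f xs) ≈ sumList (map (λ v → b * f v) xs)
    sumList-map-*ˡ []       b f = zeroʳ b
    sumList-map-*ˡ (x ∷ xs) b f = trans (distribˡ _ _ _) (+-congˡ (sumList-map-*ˡ xs b f))

    sumList-map-*ʳ : ∀ (xs : List V) b (f : V → Carrier) →
      sumList (map f xs) * b ≈ sumList (map (λ v → f v * b) xs)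
    sumList-map-*ʳ []       b f = zeroˡ b
    sumList-map-*ʳ (x ∷ xs) b f = trans (distribʳ _ _ _) (+-congˡ (sumList-map-*ʳ xs b f))

    sumList-map-++ : ∀ (xs ys : List V) (f : V → Carrier) →
      sumList (map f (xs ++ ys)) ≈ sumList (map f xs) + sumList (map f ys)
    sumList-map-++ []       ys f = sym (+-identityˡ _)
    sumList-map-++ (x ∷ xs) ys f = trans (+-congˡ (sumList-map-++ xs ys f)) (sym (+-assoc _ _ _))

    sumList-map-concatMap : ∀ {b} {W : Set b} (f : V → Carrier) (g : W → List V) (ws : List W) →
      sumList (map f (concatMap g ws)) ≈ sumList (map (λ w → sumList (map f (g w))) ws)
    sumList-map-concatMap f g []       = refl
    sumList-map-concatMap f g (w ∷ ws) =
      trans (sumList-map-++ (g w) (concatMap g ws) f) (+-congˡ (sumList-map-concatMap f g ws))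

  IsInverseFactorial : (ℕ → Carrier) → Set ℓ
  IsInverseFactorial ifac = ∀ n → fromℕ (n !) * ifac n ≈ 1#

  fromℕ-+ : ∀ m n → fromℕ (m ℕ.+ n) ≈ fromℕ m + fromℕ n
  fromℕ-+ zero    n = sym (+-identityˡ _)
  fromℕ-+ (suc m) n = trans (+-congˡ (fromℕ-+ m n)) (sym (+-assoc _ _ _))

  fromℕ-* : ∀ m n → fromℕ (m ℕ.* n) ≈ fromℕ m * fromℕ n
  fromℕ-* zero    n = sym (zeroˡ _)
  fromℕ-* (suc m) n = begin
    fromℕ (n ℕ.+ m ℕ.* n)            ≈⟨ fromℕ-+ n (m ℕ.* n) ⟩
    fromℕ n + fromℕ (m ℕ.* n)        ≈⟨ +-cong (sym (*-identityˡ _)) (fromℕ-* m n) ⟩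
    1# * fromℕ n + fromℕ m * fromℕ n ≈⟨ distribʳ _ _ _ ⟨
    fromℕ (suc m) * fromℕ n          ∎

  fromℕ-1 : fromℕ 1 ≈ 1#
  fromℕ-1 = +-identityʳ 1#

  fromℕ-^ : ∀ m n → fromℕ (m ℕ.^ n) ≈ pow (fromℕ m) n
  fromℕ-^ m zero    = fromℕ-1
  fromℕ-^ m (suc n) = trans (fromℕ-* m (m ℕ.^ n)) (*-congˡ (fromℕ-^ m n))

  pow-cong : ∀ {x y} n → x ≈ y → pow x n ≈ pow y n
  pow-cong zero    e = refl
  pow-cong (suc n) e = *-cong e (pow-cong n e)

  pow-* : ∀ x y n → pow (x * y) n ≈ pow x n * pow y n
  pow-* x y zero    = sym (*-identityˡ 1#)
  pow-* x y (suc n) = trans (*-congˡ (pow-* x y n)) (CSg.interchange *-commutativeSemigroup _ _ _ _)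

  pow-1 : ∀ n → pow 1# n ≈ 1#
  pow-1 zero    = refl
  pow-1 (suc n) = trans (*-identityˡ _) (pow-1 n)

-- Cauchy products and truncated power series.

module Convolution {c ℓ : Level} (Q : CommutativeRing c ℓ) where
  open CommutativeRing Q
  open Ops Q
  open Sums Q
  open SetoidReasoning setoid
  open NatSolver commutativeSemiring using (solve; _:+_; _:*_; _:=_)
  private module + = CSg +-commutativeSemigroup

  -- Cauchy product, by (f₀ + t f′) g = f₀ g + t f′ g.
  conv : (ℕ → Carrier) → (ℕ → Carrier) → ℕ → Carrier
  conv f g zero    = f 0 * g 0
  conv f g (suc n) = f 0 * g (suc n) + conv (f ∘ suc) g n

  -- The monomial b t^a. With `b = 1#` it also serves as the Kronecker delta.
  mon : ℕ → Carrier → ℕ → Carrier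
  mon a b n = if does (a ℕ.≟ n) then b else 0#

  conv-cong : ∀ n {f f′ g g′ : ℕ → Carrier} → (∀ m → m ≤ n → f m ≈ f′ m) →
    (∀ m → m ≤ n → g m ≈ g′ m) → conv f g n ≈ conv f′ g′ n
  conv-cong zero    e e′ = *-cong (e 0 z≤n) (e′ 0 z≤n)
  conv-cong (suc n) e e′ = +-cong (*-cong (e 0 z≤n) (e′ (suc n) ℕ.≤-refl))
    (conv-cong n (λ m m≤n → e (suc m) (s≤s m≤n)) (λ m m≤n → e′ m (ℕ.m≤n⇒m≤1+n m≤n)))

  conv-congˡ : ∀ n {f g g′ : ℕ → Carrier} → (∀ m → m ≤ n → g m ≈ g′ m) → conv f g n ≈ conv f g′ n
  conv-congˡ n e = conv-cong n (λ _ _ → refl) e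

  conv-congʳ : ∀ n {f f′ g : ℕ → Carrier} → (∀ m → m ≤ n → f m ≈ f′ m) → conv f g n ≈ conv f′ g n
  conv-congʳ n e = conv-cong n e (λ _ _ → refl)

  conv-sucʳ : ∀ f g n → conv f g (suc n) ≈ conv f (g ∘ suc) n + f (suc n) * g 0
  conv-sucʳ f g zero    = refl
  conv-sucʳ f g (suc n) = trans (+-congˡ (conv-sucʳ (f ∘ suc) g n)) (sym (+-assoc _ _ _))

  conv-comm : ∀ f g n → conv f g n ≈ conv g f n
  conv-comm f g zero    = *-comm _ _
  conv-comm f g (suc n) = begin
    f 0 * g (suc n) + conv (f ∘ suc) g n ≈⟨ +-cong (*-comm _ _) (conv-comm (f ∘ suc) g n) ⟩
    g (suc n) * f 0 + conv g (f ∘ suc) n ≈⟨ +-comm _ _ ⟩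
    conv g (f ∘ suc) n + g (suc n) * f 0 ≈⟨ conv-sucʳ g f n ⟨
    conv g f (suc n)                     ∎

  conv-distribʳ : ∀ h f g n → conv (λ m → f m + g m) h n ≈ conv f h n + conv g h n
  conv-distribʳ h f g zero    = distribʳ _ _ _
  conv-distribʳ h f g (suc n) =
    trans (+-cong (distribʳ _ _ _) (conv-distribʳ h (f ∘ suc) (g ∘ suc) n)) (+.interchange _ _ _ _)

  conv-distribˡ : ∀ h f g n → conv h (λ m → f m + g m) n ≈ conv h f n + conv h g n
  conv-distribˡ h f g n = begin
    conv h (λ m → f m + g m) n ≈⟨ conv-comm h _ n ⟩
    conv (λ m → f m + g m) h n ≈⟨ conv-distribʳ h f g n ⟩
    conv f h n + conv g h n    ≈⟨ +-cong (conv-comm f h n) (conv-comm g h n) ⟩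
    conv h f n + conv h g n    ∎

  conv-scaleˡ : ∀ b f g n → conv (λ m → b * f m) g n ≈ b * conv f g n
  conv-scaleˡ b f g zero    = *-assoc _ _ _
  conv-scaleˡ b f g (suc n) =
    trans (+-cong (*-assoc _ _ _) (conv-scaleˡ b (f ∘ suc) g n)) (sym (distribˡ _ _ _))

  conv-scaleʳ : ∀ b f g n → conv f (λ m → b * g m) n ≈ b * conv f g n
  conv-scaleʳ b f g n = begin
    conv f (λ m → b * g m) n ≈⟨ conv-comm f _ n ⟩
    conv (λ m → b * g m) f n ≈⟨ conv-scaleˡ b g f n ⟩
    b * conv g f n           ≈⟨ *-congˡ (conv-comm g f n) ⟩
    b * conv f g n           ∎

  conv-zeroˡ : ∀ g n → conv (λ _ → 0#) g n ≈ 0#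
  conv-zeroˡ g zero    = zeroˡ _
  conv-zeroˡ g (suc n) = trans (+-cong (zeroˡ _) (conv-zeroˡ g n)) (+-identityˡ 0#)

  conv-assoc : ∀ f g h n → conv (conv f g) h n ≈ conv f (conv g h) n
  conv-assoc f g h zero    = *-assoc _ _ _
  conv-assoc f g h (suc n) = begin
    f 0 * g 0 * h (suc n) + conv (λ m → f 0 * g (suc m) + conv (f ∘ suc) g m) h n
      ≈⟨ +-congˡ (conv-distribʳ h (λ m → f 0 * g (suc m)) (conv (f ∘ suc) g) n) ⟩
    f 0 * g 0 * h (suc n) + (conv (λ m → f 0 * g (suc m)) h n + conv (conv (f ∘ suc) g) h n)
      ≈⟨ +-congˡ (+-cong (conv-scaleˡ (f 0) (g ∘ suc) h n) (conv-assoc (f ∘ suc) g h n)) ⟩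
    f 0 * g 0 * h (suc n) + (f 0 * conv (g ∘ suc) h n + conv (f ∘ suc) (conv g h) n)
      ≈⟨ solve 5 (λ a b c d e → a :* b :* c :+ (a :* d :+ e) := a :* (b :* c :+ d) :+ e) refl
           (f 0) (g 0) (h (suc n)) (conv (g ∘ suc) h n) (conv (f ∘ suc) (conv g h) n) ⟩
    f 0 * (g 0 * h (suc n) + conv (g ∘ suc) h n) + conv (f ∘ suc) (conv g h) n ∎

  conv-constˡ : ∀ b g n → conv (mon 0 b) g n ≈ b * g n
  conv-constˡ b g zero    = refl
  conv-constˡ b g (suc n) = trans (+-congˡ (conv-zeroˡ g n)) (+-identityʳ _)

  conv-sum : ∀ f N (h : ℕ → ℕ → Carrier) n →
    conv f (λ m → sum N (λ k → h k m)) n ≈ sum N (λ k → conv f (h k) n)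
  conv-sum f zero    h n = trans (conv-comm f _ n) (conv-zeroˡ f n)
  conv-sum f (suc N) h n = trans (conv-distribˡ f (h 0) _ n) (+-congˡ (conv-sum f N (h ∘ suc) n))

  mon-cong : ∀ a n {b b′} → b ≈ b′ → mon a b n ≈ mon a b′ n
  mon-cong zero    zero    e = e
  mon-cong zero    (suc n) e = refl
  mon-cong (suc a) zero    e = refl
  mon-cong (suc a) (suc n) e = mon-cong a n e

  mon-zero : ∀ a n → mon a 0# n ≈ 0#
  mon-zero zero    zero    = refl
  mon-zero zero    (suc n) = refl
  mon-zero (suc a) zero    = refl
  mon-zero (suc a) (suc n) = mon-zero a n

  mon-diag : ∀ n {b} → mon n b n ≈ b
  mon-diag zero    = refl
  mon-diag (suc n) = mon-diag n

  mon-< : ∀ {a n b} → n < a → mon a b n ≈ 0#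
  mon-< {suc a} {zero}  n<a       = refl
  mon-< {suc a} {suc n} (s≤s n<a) = mon-< {a} {n} n<a

  mon-> : ∀ {a n b} → a < n → mon a b n ≈ 0#
  mon-> {zero}  {suc n} a<n       = refl
  mon-> {suc a} {suc n} (s≤s a<n) = mon-> {a} {n} a<n

  scale-mon : ∀ b a e n → b * mon a e n ≈ mon a (b * e) n
  scale-mon b zero    e zero    = refl
  scale-mon b zero    e (suc n) = zeroʳ b
  scale-mon b (suc a) e zero    = zeroʳ b
  scale-mon b (suc a) e (suc n) = scale-mon b a e n

  conv-mon : ∀ a a′ b b′ n → conv (mon a b) (mon a′ b′) n ≈ mon (a ℕ.+ a′) (b * b′) n
  conv-mon zero    a′ b b′ n       = trans (conv-constˡ b (mon a′ b′) n) (scale-mon b a′ b′ n)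
  conv-mon (suc a) a′ b b′ zero    = zeroˡ _
  conv-mon (suc a) a′ b b′ (suc n) =
    trans (+-cong (zeroˡ _) (conv-mon a a′ b b′ n)) (+-identityˡ _)

  sum-mon : ∀ N (f : ℕ → Carrier) k → k < N → sum N (λ e → mon e (f e) k) ≈ f k
  sum-mon (suc N) f zero    k<N       =
    trans (+-congˡ (sum-zero N λ _ _ → refl)) (+-identityʳ _)
  sum-mon (suc N) f (suc k) (s≤s k<N) = trans (+-identityˡ _) (sum-mon N (f ∘ suc) k k<N)

  sum-δ : ∀ N j (f : ℕ → Carrier) → j < N → sum N (λ l → mon j 1# l * f l) ≈ f j
  sum-δ (suc N) zero    f j<N       =
    trans (+-cong (*-identityˡ _) (sum-zero N λ _ _ → zeroˡ _)) (+-identityʳ _)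
  sum-δ (suc N) (suc j) f (s≤s j<N) =
    trans (+-cong (zeroˡ _) (sum-δ N j (f ∘ suc) j<N)) (+-identityˡ _)

  -- The ring Q[[t]]/(t^{N+1}), presented as all of Q[[t]] with a coarser equality.
  module _ (N : ℕ) where

    infix 4 _≋_
    record _≋_ (f g : ℕ → Carrier) : Set ℓ where
      constructor agree
      field at : ∀ n → n ≤ N → f n ≈ g n

    Jets : CommutativeRing c ℓ
    Jets = record
      { Carrier = ℕ → Carrier
      ; _≈_ = _≋_
      ; _+_ = λ f g n → f n + g n
      ; _*_ = conv
      ; -_ = λ f n → - f n
      ; 0# = λ _ → 0#
      ; 1# = mon 0 1#
      ; isCommutativeRing = record
        { isRing = record
          { +-isAbelianGroup = record
            { isGroup = record
              { isMonoid = record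
                { isSemigroup = record
                  { isMagma = record
                    { isEquivalence = record
                      { refl  = agree λ _ _ → refl
                      ; sym   = λ (agree p) → agree λ n n≤N → sym (p n n≤N)
                      ; trans = λ (agree p) (agree q) → agree λ n n≤N → trans (p n n≤N) (q n n≤N)
                      }
                    ; ∙-cong = λ (agree p) (agree q) → agree λ n n≤N → +-cong (p n n≤N) (q n n≤N)
                    }
                  ; assoc = λ f g h → agree λ n _ → +-assoc _ _ _
                  }
                ; identity = (λ f → agree λ n _ → +-identityˡ _) , (λ f → agree λ n _ → +-identityʳ _)
                }
              ; inverse = (λ f → agree λ n _ → -‿inverseˡ _) , (λ f → agree λ n _ → -‿inverseʳ _)
              ; ⁻¹-cong = λ (agree p) → agree λ n n≤N → -‿cong (p n n≤N)
              }
            ; comm = λ f g → agree λ n _ → +-comm _ _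
            }
          ; *-cong = λ (agree p) (agree q) → agree λ n n≤N →
              conv-cong n (λ m m≤n → p m (ℕ.≤-trans m≤n n≤N)) (λ m m≤n → q m (ℕ.≤-trans m≤n n≤N))
          ; *-assoc = λ f g h → agree λ n _ → conv-assoc f g h n
          ; *-identity = (λ f → agree λ n _ → trans (conv-constˡ 1# f n) (*-identityˡ _))
                       , (λ f → agree λ n _ → trans (conv-comm f (mon 0 1#) n)
                                                    (trans (conv-constˡ 1# f n) (*-identityˡ _)))
          ; distrib = (λ f g h → agree λ n _ → conv-distribˡ f g h n)
                    , (λ f g h → agree λ n _ → conv-distribʳ f g h n)
          }
        ; *-comm = λ f g → agree λ n _ → conv-comm f g n
        }
      }

  -- Powers free of the truncation bound carried by `Jets N`; `pow-Jets` shows that they are the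
  -- same sequences.
  spow : (ℕ → Carrier) → ℕ → ℕ → Carrier
  spow f zero    = mon 0 1#
  spow f (suc k) = conv f (spow f k)

  pow-mon : ∀ N a b e → CommutativeRing._≈_ (Jets N) (Ops.pow (Jets N) (mon a b) e) (mon (a ℕ.* e) (pow b e))
  pow-mon N a b zero    = reflexiveJ (≡.cong (λ j → mon j 1#) (≡.sym (ℕ.*-zeroʳ a)))
    where open CommutativeRing (Jets N) renaming (reflexive to reflexiveJ) using ()
  pow-mon N a b (suc e) = agree λ n n≤N → begin
    conv (mon a b) (Ops.pow (Jets N) (mon a b) e) n
      ≈⟨ conv-congˡ n (λ m m≤n → _≋_.at (pow-mon N a b e) m (ℕ.≤-trans m≤n n≤N)) ⟩
    conv (mon a b) (mon (a ℕ.* e) (pow b e)) n      ≈⟨ conv-mon a (a ℕ.* e) b (pow b e) n ⟩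
    mon (a ℕ.+ a ℕ.* e) (b * pow b e) n             ≡⟨ ≡.cong (λ j → mon j (b * pow b e) n) (ℕ.*-suc a e) ⟨
    mon (a ℕ.* suc e) (pow b (suc e)) n             ∎

  pow-Jets : ∀ N f k → Ops.pow (Jets N) f k ≡ spow f k
  pow-Jets N f zero    = ≡.refl
  pow-Jets N f (suc k) = ≡.cong (conv f) (pow-Jets N f k)

  sum-Jets : ∀ N m (F : ℕ → ℕ → Carrier) j → Sums.sum (Jets N) m F j ≡ sum m (λ e → F e j)
  sum-Jets N zero    F j = ≡.refl
  sum-Jets N (suc m) F j = ≡.cong (F 0 j +_) (sum-Jets N m (F ∘ suc) j)

  sumList-Jets : ∀ {a} {V : Set a} N (F : V → ℕ → Carrier) (vs : List V) j →
    Ops.sumList (Jets N) (map F vs) j ≡ sumList (map (λ v → F v j) vs)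
  sumList-Jets N F []       j = ≡.refl
  sumList-Jets N F (v ∷ vs) j = ≡.cong (F v j +_) (sumList-Jets N F vs j)

  fromℕ-Jets : ∀ N m → CommutativeRing._≈_ (Jets N) (Ops.fromℕ (Jets N) m) (mon 0 (fromℕ m))
  fromℕ-Jets N zero    = agree λ n _ → sym (mon-zero 0 n)
  fromℕ-Jets N (suc m) = agree λ { zero    p → +-congˡ (_≋_.at (fromℕ-Jets N m) 0 p)
                                 ; (suc n) p → trans (+-congˡ (_≋_.at (fromℕ-Jets N m) (suc n) p)) (+-identityˡ _) }

-- Composition of power series.

module Composition {c ℓ : Level} (Q : CommutativeRing c ℓ) where
  open CommutativeRing Q
  open Ops Q
  open Sums Q
  open Convolution Q
  open SetoidReasoning setoid

  infixr 5 _⊙_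
  -- The composite f ∘ φ, with the inner series written first. Stopping at k = n loses nothing when
  -- φ has no constant term, since φ^k then starts in degree k.
  _⊙_ : (ℕ → Carrier) → (ℕ → Carrier) → ℕ → Carrier
  (φ ⊙ f) n = sum (suc n) (λ k → f k * spow φ k n)

  spow-cong : ∀ {f g : ℕ → Carrier} → (∀ n → f n ≈ g n) → ∀ k n → spow f k n ≈ spow g k n
  spow-cong e zero    n = refl
  spow-cong e (suc k) n = conv-cong n (λ m _ → e m) (λ m _ → spow-cong e k m)

  conv-zeroʳ : ∀ f {g : ℕ → Carrier} n → (∀ m → m ≤ n → g m ≈ 0#) → conv f g n ≈ 0#
  conv-zeroʳ f n e = trans (conv-congˡ n e) (trans (conv-comm f _ n) (conv-zeroˡ f n))

  conv-top : ∀ f {g : ℕ → Carrier} n → (∀ m → m < n → g m ≈ 0#) → conv f g n ≈ f 0 * g n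
  conv-top f zero    e = refl
  conv-top f (suc n) e =
    trans (+-congˡ (conv-zeroʳ (f ∘ suc) n λ m m≤n → e m (s≤s m≤n))) (+-identityʳ _)

  module _ (φ : ℕ → Carrier) (φ₀ : φ 0 ≈ 0#) where

    -- As φ₀ = 0, φ is t times its shift, so multiplication by φ raises the degree; the inductions
    -- on the degree rest on this.
    conv-shift : ∀ g n → conv φ g (suc n) ≈ conv (φ ∘ suc) g n
    conv-shift g n = trans (+-congʳ (trans (*-congʳ φ₀) (zeroˡ _))) (+-identityˡ _)

    spow-< : ∀ k n → n < k → spow φ k n ≈ 0#
    spow-< (suc k) zero    n<k       = trans (*-congʳ φ₀) (zeroˡ _)
    spow-< (suc k) (suc n) (s≤s n<k) = trans (conv-shift (spow φ k) n)
      (conv-zeroʳ (φ ∘ suc) n λ m m≤n → spow-< k m (ℕ.≤-<-trans m≤n n<k))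

    spow-diag : ∀ n → spow φ n n ≈ pow (φ 1) n
    spow-diag zero    = refl
    spow-diag (suc n) = begin
      conv φ (spow φ n) (suc n)   ≈⟨ conv-shift (spow φ n) n ⟩
      conv (φ ∘ suc) (spow φ n) n ≈⟨ conv-top (φ ∘ suc) n (λ m m<n → spow-< n m m<n) ⟩
      φ 1 * spow φ n n            ≈⟨ *-congˡ (spow-diag n) ⟩
      φ 1 * pow (φ 1) n           ∎

    ⊙-+ : ∀ f g n → (φ ⊙ (λ m → f m + g m)) n ≈ (φ ⊙ f) n + (φ ⊙ g) n
    ⊙-+ f g n = trans
      (sum-cong (suc n) λ k _ → distribʳ (spow φ k n) (f k) (g k))
      (sum-+ (suc n) (λ k → f k * spow φ k n) (λ k → g k * spow φ k n))

    ⊙-scale : ∀ b f n → (φ ⊙ (λ m → b * f m)) n ≈ b * (φ ⊙ f) n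
    ⊙-scale b f n = trans
      (sum-cong (suc n) λ k _ → *-assoc b (f k) (spow φ k n))
      (sym (sum-*ˡ (suc n) b (λ k → f k * spow φ k n)))

    ⊙-1 : ∀ n → (φ ⊙ mon 0 1#) n ≈ mon 0 1# n
    ⊙-1 n = trans (+-cong (*-identityˡ _) (sum-zero n λ _ _ → zeroˡ _)) (+-identityʳ _)

    ⊙-zero : ∀ f → (φ ⊙ f) 0 ≈ f 0
    ⊙-zero f = trans (+-identityʳ _) (*-identityʳ _)

    -- f ∘ φ = f₀ + φ · (f′ ∘ φ) where f = f₀ + t f′.
    ⊙-suc : ∀ f n → (φ ⊙ f) (suc n) ≈ conv (φ ∘ suc) (φ ⊙ (f ∘ suc)) n
    ⊙-suc f n = begin
      f 0 * 0# + sum (suc n) (λ k → f (suc k) * conv φ (spow φ k) (suc n))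
        ≈⟨ trans (+-congʳ (zeroʳ _)) (+-identityˡ _) ⟩
      sum (suc n) (λ k → f (suc k) * conv φ (spow φ k) (suc n))
        ≈⟨ sum-cong (suc n) (λ k _ → trans (*-congˡ (conv-shift (spow φ k) n))
                                           (sym (conv-scaleʳ (f (suc k)) (φ ∘ suc) (spow φ k) n))) ⟩
      sum (suc n) (λ k → conv (φ ∘ suc) (λ m → f (suc k) * spow φ k m) n)
        ≈⟨ conv-sum (φ ∘ suc) (suc n) (λ k m → f (suc k) * spow φ k m) n ⟨
      conv (φ ∘ suc) (λ m → sum (suc n) (λ k → f (suc k) * spow φ k m)) n
        -- The composite in degree `m` sums only up to `m`; the bound `n` common to all `m` adds
        -- terms with k > m, where φ^k has no coefficient.
        ≈⟨ conv-congˡ n (λ m m≤n → sym (sum-extend (suc m) (suc n) (s≤s m≤n) λ k m<k →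
             trans (*-congˡ {f (suc k)} (spow-< k m m<k)) (zeroʳ _))) ⟩
      conv (φ ∘ suc) (φ ⊙ (f ∘ suc)) n ∎

    -- The tail of f g is f₀ times the tail of g plus the tail of f times g, so `⊙-suc` trades
    -- degree n + 1 for degrees at most n.
    ⊙-conv : ∀ n f g → (φ ⊙ conv f g) n ≈ conv (φ ⊙ f) (φ ⊙ g) n
    ⊙-conv n f g = go n n ℕ.≤-refl f g
      where
      -- the recursion needs the claim for all smaller degrees, hence the fuel N
      go : ∀ N n → n ≤ N → ∀ f g → (φ ⊙ conv f g) n ≈ conv (φ ⊙ f) (φ ⊙ g) n
      go N zero n≤N f g = trans (⊙-zero (conv f g)) (sym (*-cong (⊙-zero f) (⊙-zero g)))
      go (suc N) (suc n) (s≤s n≤N) f g = begin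
        (φ ⊙ conv f g) (suc n)
          ≈⟨ ⊙-suc (conv f g) n ⟩
        conv φ′ (φ ⊙ (λ m → f 0 * g (suc m) + conv (f ∘ suc) g m)) n
          ≈⟨ conv-congˡ n (λ m m≤n → trans (⊙-+ (λ m → f 0 * g (suc m)) (conv (f ∘ suc) g) m)
               (+-cong (⊙-scale (f 0) (g ∘ suc) m) (go N m (ℕ.≤-trans m≤n n≤N) (f ∘ suc) g))) ⟩
        conv φ′ (λ m → f 0 * (φ ⊙ (g ∘ suc)) m + conv (φ ⊙ (f ∘ suc)) (φ ⊙ g) m) n
          ≈⟨ conv-distribˡ φ′ (λ m → f 0 * (φ ⊙ (g ∘ suc)) m) (conv (φ ⊙ (f ∘ suc)) (φ ⊙ g)) n ⟩
        conv φ′ (λ m → f 0 * (φ ⊙ (g ∘ suc)) m) n + conv φ′ (conv (φ ⊙ (f ∘ suc)) (φ ⊙ g)) n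
          ≈⟨ +-cong (conv-scaleʳ (f 0) φ′ (φ ⊙ (g ∘ suc)) n)
                    (sym (conv-assoc φ′ (φ ⊙ (f ∘ suc)) (φ ⊙ g) n)) ⟩
        f 0 * conv φ′ (φ ⊙ (g ∘ suc)) n + conv (conv φ′ (φ ⊙ (f ∘ suc))) (φ ⊙ g) n
          ≈⟨ +-cong (*-cong (⊙-zero f) (⊙-suc g n)) (conv-congʳ n λ m _ → ⊙-suc f m) ⟨
        conv (φ ⊙ f) (φ ⊙ g) (suc n) ∎
        where φ′ = φ ∘ suc

    ⊙-spow : ∀ f k n → (φ ⊙ spow f k) n ≈ spow (φ ⊙ f) k n
    ⊙-spow f zero    n = ⊙-1 n
    ⊙-spow f (suc k) n = trans (⊙-conv n f (spow f k)) (conv-congˡ n λ m _ → ⊙-spow f k m)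

-- Divisibility of factorials.

m!*n!∣[m+n]! : ∀ m n → m ! ℕ.* n ! ∣ (m ℕ.+ n) !
m!*n!∣[m+n]! m n =
  ≡.subst (λ j → m ! ℕ.* j ! ∣ (m ℕ.+ n) !) (ℕ.m+n∸m≡n m n) (k![n∸k]!∣n! (ℕ.m≤m+n m n))

-- The leading factor (i + 1)(r + 1) of ((i + 1)(r + 1))! supplies the factor r + 1 of (r + 1)!
-- and the factor i + 1 of one (i + 1)!.
r!*i!^r∣[i*r]! : ∀ i r → r ! ℕ.* (suc i !) ℕ.^ r ∣ (suc i ℕ.* r) !
r!*i!^r∣[i*r]! i zero    = ∣-reflexive (≡.sym (≡.cong _! (ℕ.*-zeroʳ (suc i))))
r!*i!^r∣[i*r]! i (suc r) = begin
  suc r ! ℕ.* (suc i !) ℕ.^ suc r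
    ≡⟨ solve 5 (λ a b c d e → a :* b :* (c :* d :* e) := c :* a :* (d :* (b :* e))) ≡.refl
         (suc r) (r !) (suc i) (i !) ((suc i !) ℕ.^ r) ⟩
  suc i ℕ.* suc r ℕ.* (i ! ℕ.* (r ! ℕ.* (suc i !) ℕ.^ r))
    ∣⟨ *-monoʳ-∣ (suc i ℕ.* suc r) (*-monoʳ-∣ (i !) (r!*i!^r∣[i*r]! i r)) ⟩
  suc i ℕ.* suc r ℕ.* (i ! ℕ.* (suc i ℕ.* r) !)
    ∣⟨ *-monoʳ-∣ (suc i ℕ.* suc r) (m!*n!∣[m+n]! i (suc i ℕ.* r)) ⟩
  suc i ℕ.* suc r ℕ.* (i ℕ.+ suc i ℕ.* r) !
    ≡⟨ ≡.cong (ℕ._* (i ℕ.+ suc i ℕ.* r) !) (ℕ.*-suc (suc i) r) ⟩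
  suc (i ℕ.+ suc i ℕ.* r) !
    ≡⟨ ≡.cong _! (ℕ.*-suc (suc i) r) ⟨
  (suc i ℕ.* suc r) ! ∎
  where
  open ∣-Reasoning
  open ℕSolver.+-*-Solver using (solve; _:*_; _:=_)

-- The exponential series and its functional equation.

module Exponential {c ℓ : Level} (Q : CommutativeRing c ℓ)
  (ifac : ℕ → CommutativeRing.Carrier Q) (ifac-inv : Sums.IsInverseFactorial Q ifac) where

  open CommutativeRing Q
  open Ops Q
  open Sums Q
  open Convolution Q
  open SetoidReasoning setoid
  open NatSolver commutativeSemiring using (solve; _:+_; _:*_; _:=_; con)

  ifac-0 : ifac 0 ≈ 1#
  ifac-0 = trans (sym (trans (*-congʳ fromℕ-1) (*-identityˡ _))) (ifac-inv 0)

  -- Only `n! * ifac n ≈ 1#` is assumed, so the recurrence between successive values comes from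
  -- uniqueness of inverses.
  ifac-suc : ∀ k → fromℕ (suc k) * ifac (suc k) ≈ ifac k
  ifac-suc k = begin
    fromℕ (suc k) * ifac (suc k)                              ≈⟨ *-identityʳ _ ⟨
    fromℕ (suc k) * ifac (suc k) * 1#                         ≈⟨ *-congˡ (ifac-inv k) ⟨
    fromℕ (suc k) * ifac (suc k) * (fromℕ (k !) * ifac k)
      ≈⟨ solve 4 (λ a b c d → a :* b :* (c :* d) := a :* c :* b :* d) refl _ _ _ _ ⟩
    fromℕ (suc k) * fromℕ (k !) * ifac (suc k) * ifac k       ≈⟨ *-congʳ (*-congʳ (fromℕ-* (suc k) (k !))) ⟨
    fromℕ (suc k !) * ifac (suc k) * ifac k                   ≈⟨ *-congʳ (ifac-inv (suc k)) ⟩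
    1# * ifac k                                               ≈⟨ *-identityˡ _ ⟩
    ifac k                                                    ∎

  -- The numeral k + 1 is a unit, with inverse k!/(k+1)!.
  fromℕ-cancel : ∀ k {x y} → fromℕ (suc k) * x ≈ fromℕ (suc k) * y → x ≈ y
  fromℕ-cancel k {x} {y} e = trans (sym (undo x)) (trans (*-congˡ e) (undo y))
    where
    undo : ∀ z → fromℕ (k !) * ifac (suc k) * (fromℕ (suc k) * z) ≈ z
    undo z = begin
      fromℕ (k !) * ifac (suc k) * (fromℕ (suc k) * z)
        ≈⟨ solve 4 (λ a b c d → a :* b :* (c :* d) := a :* (c :* b) :* d) refl _ _ _ _ ⟩
      fromℕ (k !) * (fromℕ (suc k) * ifac (suc k)) * z ≈⟨ *-congʳ (*-congˡ (ifac-suc k)) ⟩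
      fromℕ (k !) * ifac k * z                         ≈⟨ *-congʳ (ifac-inv k) ⟩
      1# * z                                           ≈⟨ *-identityˡ z ⟩
      z                                                ∎

  -- Euler derivation t d/dt
  θ : (ℕ → Carrier) → ℕ → Carrier
  θ f n = fromℕ n * f n

  -- Leibniz rule. The extra summand `X` in the step arises from θ(t h) = t (h + θ h), applied to
  -- the tail.
  θ-conv : ∀ f g n → θ (conv f g) n ≈ conv (θ f) g n + conv f (θ g) n
  θ-conv f g zero    =
    solve 2 (λ a b → con 0 :* (a :* b) := con 0 :* a :* b :+ a :* (con 0 :* b)) refl (f 0) (g 0)
  θ-conv f g (suc n) = begin
    (1# + fromℕ n) * (f 0 * g (suc n) + X)
      ≈⟨ solve 4 (λ a b m x → (con 1 :+ m) :* (a :* b :+ x) :=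
                              x :+ m :* x :+ a :* ((con 1 :+ m) :* b)) refl (f 0) (g (suc n)) (fromℕ n) X ⟩
    X + fromℕ n * X + f 0 * θ g (suc n)
      ≈⟨ +-congʳ (+-congˡ (θ-conv (f ∘ suc) g n)) ⟩
    X + (U + V) + f 0 * θ g (suc n)
      ≈⟨ solve 6 (λ a b w x u v → x :+ (u :+ v) :+ w := con 0 :* a :* b :+ (x :+ u) :+ (w :+ v)) refl
           (f 0) (g (suc n)) (f 0 * θ g (suc n)) X U V ⟩
    0# * f 0 * g (suc n) + (X + U) + (f 0 * θ g (suc n) + V)
      ≈⟨ +-congʳ (+-congˡ (conv-distribʳ g (f ∘ suc) (θ (f ∘ suc)) n)) ⟨
    0# * f 0 * g (suc n) + conv (λ m → f (suc m) + θ (f ∘ suc) m) g n + (f 0 * θ g (suc n) + V)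
      ≈⟨ +-congʳ (+-congˡ (conv-congʳ n λ m _ →
           solve 2 (λ m a → a :+ m :* a := (con 1 :+ m) :* a) refl (fromℕ m) (f (suc m)))) ⟩
    conv (θ f) g (suc n) + conv f (θ g) (suc n) ∎
    where
    X = conv (f ∘ suc) g n
    U = conv (θ (f ∘ suc)) g n
    V = conv (f ∘ suc) (θ g) n

  -- The series exp(a s) in a variable s; its parameter `a` will itself be a series in t.
  exp : Carrier → ℕ → Carrier
  exp a k = pow a k * ifac k

  exp-cong : ∀ {a b} k → a ≈ b → exp a k ≈ exp b k
  exp-cong k e = *-congʳ (pow-cong k e)

  exp-0 : ∀ k → exp 0# k ≈ mon 0 1# k
  exp-0 zero    = trans (*-identityˡ _) ifac-0
  exp-0 (suc k) = trans (*-congʳ (zeroˡ _)) (zeroˡ _)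

  θ-exp : ∀ a k → θ (exp a) (suc k) ≈ a * exp a k
  θ-exp a k = begin
    fromℕ (suc k) * (a * pow a k * ifac (suc k))
      ≈⟨ solve 4 (λ m a p i → m :* (a :* p :* i) := a :* (p :* (m :* i))) refl _ _ _ _ ⟩
    a * (pow a k * (fromℕ (suc k) * ifac (suc k))) ≈⟨ *-congˡ (*-congˡ (ifac-suc k)) ⟩
    a * exp a k ∎

  -- The differential equation θ(exp(a s)) = a s exp(a s), multiplied by another series; the factor
  -- s is the shift of the index.
  conv-θ-exp : ∀ a g k → conv (θ (exp a)) g (suc k) ≈ a * conv (exp a) g k
  conv-θ-exp a g k = begin
    0# * exp a 0 * g (suc k) + conv (θ (exp a) ∘ suc) g k
      ≈⟨ +-cong (trans (*-congʳ (zeroˡ _)) (zeroˡ _)) (conv-congʳ k λ m _ → θ-exp a m) ⟩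
    0# + conv (λ m → a * exp a m) g k                     ≈⟨ +-identityˡ _ ⟩
    conv (λ m → a * exp a m) g k                          ≈⟨ conv-scaleˡ a (exp a) g k ⟩
    a * conv (exp a) g k                                  ∎

  -- Both sides solve F′ = (a + b) F with F(0) = 1.
  exp-+ : ∀ a b k → conv (exp a) (exp b) k ≈ exp (a + b) k
  exp-+ a b zero    = trans (*-congˡ (trans (*-identityˡ _) ifac-0)) (*-identityʳ _)
  exp-+ a b (suc k) = fromℕ-cancel k (begin
    θ (conv (exp a) (exp b)) (suc k)
      ≈⟨ θ-conv (exp a) (exp b) (suc k) ⟩
    conv (θ (exp a)) (exp b) (suc k) + conv (exp a) (θ (exp b)) (suc k)
      ≈⟨ +-cong (conv-θ-exp a (exp b) k) (trans (conv-comm (exp a) (θ (exp b)) (suc k))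
           (trans (conv-θ-exp b (exp a) k) (*-congˡ (conv-comm (exp b) (exp a) k)))) ⟩
    a * conv (exp a) (exp b) k + b * conv (exp a) (exp b) k
      ≈⟨ distribʳ _ _ _ ⟨
    (a + b) * conv (exp a) (exp b) k
      ≈⟨ *-congˡ (exp-+ a b k) ⟩
    (a + b) * exp (a + b) k
      ≈⟨ θ-exp (a + b) k ⟨
    fromℕ (suc k) * exp (a + b) (suc k) ∎)

-- Bell polynomials as coefficients of powers of a generating function.

module Bell {c ℓ : Level} (R : CommutativeRing c ℓ)
  (ifac : ℕ → CommutativeRing.Carrier R) (ifac-inv : Sums.IsInverseFactorial R ifac) where

  open CommutativeRing R
  open Ops R
  open Sums R
  open Convolution R
  open Composition R
  open SetoidReasoning setoid
  open NatSolver commutativeSemiring using (solve; _:+_; _:*_; _:=_; con)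

  -- The series x̂. Its constant term is 0, so that it may be substituted into other series.
  egf : (ℕ → Carrier) → ℕ → Carrier
  egf x zero    = 0#
  egf x (suc n) = x (suc n) * ifac (suc n)

  -- Makes the division in ℕ in the explicit formula exact. The index is `suc i` because r! need not
  -- divide (0 · r)! = 1.
  den∣[Σir]! : ∀ {len} i (v : Vec ℕ len) → den (suc i) v ∣ (Σir (suc i) v) !
  den∣[Σir]! i []       = ∣-refl
  den∣[Σir]! i (r ∷ rs) = ∣-trans (*-pres-∣ (r!*i!^r∣[i*r]! i r) (den∣[Σir]! (suc i) rs))
                                 (m!*n!∣[m+n]! (suc i ℕ.* r) (Σir (suc (suc i)) rs))

  module _ (x : ℕ → Carrier) where

    -- The product of the (x_i / i!)^{r_i} / r_i!: what the exponent vector contributes to the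
    -- product of the exponentials.
    weight : ∀ {len} → ℕ → Vec ℕ len → Carrier
    weight i []       = 1#
    weight i (r ∷ rs) = pow (x i * ifac i) r * ifac r * weight (suc i) rs

    den-weight : ∀ {len} i (v : Vec ℕ len) → fromℕ (den i v) * weight i v ≈ mono x i v
    den-weight i []       = trans (*-identityʳ _) fromℕ-1
    den-weight i (r ∷ rs) = begin
      fromℕ (r ! ℕ.* (i !) ℕ.^ r ℕ.* den (suc i) rs) * (pow (x i * ifac i) r * ifac r * weight (suc i) rs)
        ≈⟨ *-cong (trans (fromℕ-* (r ! ℕ.* (i !) ℕ.^ r) (den (suc i) rs))
                   (*-congʳ (trans (fromℕ-* (r !) ((i !) ℕ.^ r)) (*-congˡ (fromℕ-^ (i !) r)))))
             (*-congʳ (*-congʳ (pow-* (x i) (ifac i) r))) ⟩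
      fromℕ (r !) * pow (fromℕ (i !)) r * fromℕ (den (suc i) rs) *
        (pow (x i) r * pow (ifac i) r * ifac r * weight (suc i) rs)
        ≈⟨ solve 7 (λ a b c d e f g → a :* b :* c :* (d :* e :* f :* g) := a :* f :* (b :* e) :* (d :* (c :* g))) refl _ _ _ _ _ _ _ ⟩
      fromℕ (r !) * ifac r * (pow (fromℕ (i !)) r * pow (ifac i) r) *
        (pow (x i) r * (fromℕ (den (suc i) rs) * weight (suc i) rs))
        ≈⟨ *-cong (*-cong (ifac-inv r) (trans (sym (pow-* _ _ r)) (trans (pow-cong r (ifac-inv i)) (pow-1 r))))
                  (*-congˡ (den-weight (suc i) rs)) ⟩
      1# * 1# * (pow (x i) r * mono x (suc i) rs)
        ≈⟨ trans (*-congʳ (*-identityˡ 1#)) (*-identityˡ _) ⟩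
      pow (x i) r * mono x (suc i) rs ∎

    multinomial-weight : ∀ {len} n (v : Vec ℕ len) → Σir 1 v ≡ n →
      fromℕ (ℕ._/_ (n !) (den 1 v) {{den-nz 1 v}}) * mono x 1 v ≈ fromℕ (n !) * weight 1 v
    multinomial-weight n v ≡.refl = begin
      fromℕ q * mono x 1 v                      ≈⟨ *-congˡ (den-weight 1 v) ⟨
      fromℕ q * (fromℕ (den 1 v) * weight 1 v)  ≈⟨ *-assoc _ _ _ ⟨
      fromℕ q * fromℕ (den 1 v) * weight 1 v    ≈⟨ *-congʳ (fromℕ-* q (den 1 v)) ⟨
      fromℕ (q ℕ.* den 1 v) * weight 1 v
        ≡⟨ ≡.cong (λ m → fromℕ m * weight 1 v) (m/n*n≡m {{den-nz 1 v}} (den∣[Σir]! 0 v)) ⟩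
      fromℕ (n !) * weight 1 v                  ∎
      where q = ℕ._/_ (n !) (den 1 v) {{den-nz 1 v}}

    -- S is the ring of series in t, which records Σ i r_i, and SS = S[[s]], where s records Σ r_i.
    module _ (n K : ℕ) where
      private
        S  = Jets n
        module S = CommutativeRing S
        module SumS = Sums S
        module ConvS = Convolution S
        SS = ConvS.Jets K
        module SS = CommutativeRing SS
        module SumSS = Sums SS
      open ConvS using () renaming (mon to monS; agree to agreeS; _≋_ to _≋S_)

      private
        ifacS : ℕ → S.Carrier
        ifacS m = mon 0 (ifac m)

        ifacS-inv : ∀ m → Ops.fromℕ S (m !) S.* ifacS m S.≈ S.1#
        ifacS-inv m = S.trans (S.*-congʳ (fromℕ-Jets n (m !)))
          (agree λ j _ → trans (conv-mon 0 0 _ _ j) (mon-cong 0 j (ifac-inv m)))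

        module ExpS = Exponential S ifacS ifacS-inv

      -- The r-th divided power of x_i t^i / i!.
      divided : ℕ → ℕ → S.Carrier
      divided i r = mon (i ℕ.* r) (pow (x i * ifac i) r * ifac r)

      factor : ℕ → ℕ → SS.Carrier
      factor i r = monS r (divided i r)

      -- The exponents of s and t record the two sums tested in `bellTerm`, so extracting one
      -- coefficient replaces both tests.
      term : ∀ {len} → ℕ → Vec ℕ len → SS.Carrier
      term i v = monS (Σr v) (mon (Σir i v) (weight i v))

      term-∷ : ∀ {len} i r (rs : Vec ℕ len) → term i (r ∷ rs) SS.≈ factor i r SS.* term (suc i) rs
      term-∷ i r rs = agreeS λ k _ → S.sym (S.trans
        (ConvS.conv-mon r (Σr rs) _ _ k)
        (ConvS.mon-cong (r ℕ.+ Σr rs) k (agree λ m _ → conv-mon (i ℕ.* r) (Σir (suc i) rs) _ _ m)))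

      arg : ℕ → S.Carrier
      arg i = mon i (x i * ifac i)

      exp-arg : ∀ i k → ExpS.exp (arg i) k S.≈ divided i k
      exp-arg i k = S.trans (S.*-congʳ (pow-mon n i (x i * ifac i) k)) (agree λ m _ → begin
        conv (mon (i ℕ.* k) (pow (x i * ifac i) k)) (mon 0 (ifac k)) m ≈⟨ conv-mon (i ℕ.* k) 0 _ _ m ⟩
        mon (i ℕ.* k ℕ.+ 0) (pow (x i * ifac i) k * ifac k) m
          ≡⟨ ≡.cong (λ a → mon a (pow (x i * ifac i) k * ifac k) m) (ℕ.+-identityʳ (i ℕ.* k)) ⟩
        mon (i ℕ.* k) (pow (x i * ifac i) k * ifac k) m                ∎)

      -- The truncation e ≤ n is harmless, because t^{ie} vanishes in S for e > n.
      factor-sum : ∀ i → Ops.sumList SS (map (factor (suc i)) (upTo (suc n))) SS.≈ ExpS.exp (arg (suc i))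
      factor-sum i = SS.trans (SS.reflexive (SumSS.sumList-map-upTo (suc n) (factor (suc i))))
        (agreeS λ k _ → S.trans (S.reflexive (ConvS.sum-Jets K (suc n) (factor (suc i)) k)) (coefficient k))
        where
        high : ∀ k → n < k → ∀ {b} → mon (suc i ℕ.* k) b S.≈ S.0#
        high k n<k = agree λ m m≤n → mon-< {suc i ℕ.* k}
          (ℕ.≤-trans (s≤s m≤n) (ℕ.≤-trans n<k (ℕ.m≤m+n k (i ℕ.* k))))

        coefficient : ∀ k → SumS.sum (suc n) (λ e → factor (suc i) e k) S.≈ ExpS.exp (arg (suc i)) k
        coefficient k with k ℕ.<? suc n
        ... | yes k≤n = S.trans (ConvS.sum-mon (suc n) (divided (suc i)) k k≤n) (S.sym (exp-arg (suc i) k))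
        ... | no  k≰n = S.trans
          (SumS.sum-zero (suc n) λ e e≤n → ConvS.mon-> {e} {k} {divided (suc i) e} (ℕ.≤-trans e≤n (ℕ.≮⇒≥ k≰n)))
          (S.sym (S.trans (exp-arg (suc i) k) (high k (ℕ.≮⇒≥ k≰n))))

      -- Since `term` is multiplicative in the entries, distributivity turns the sum over vectors
      -- into a product of one exponential per position, and `exp-+` merges these.
      term-sum : ∀ i len → Ops.sumList SS (map (term (suc i)) (vecs n len)) SS.≈
        ExpS.exp (SumS.sum len (λ p → arg (suc i ℕ.+ p)))
      term-sum i zero      = agreeS λ k _ → S.trans (zero-term k) (S.sym (ExpS.exp-0 k))
        where
        zero-term : ∀ k → monS 0 (mon 0 1#) k S.+ S.0# S.≈ monS 0 S.1# k
        zero-term k = S.+-identityʳ _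
      term-sum i (suc len) = SSR.begin
        Ops.sumList SS (map (term (suc i)) (vecs n (suc len)))
          SSR.≈⟨ SumSS.sumList-map-concatMap (term (suc i)) (λ v → map (_∷ v) (upTo (suc n))) (vecs n len) ⟩
        Ops.sumList SS (map (λ v → Ops.sumList SS (map (term (suc i)) (map (_∷ v) (upTo (suc n))))) (vecs n len))
          SSR.≈⟨ SumSS.sumList-map-cong (vecs n len) extend ⟩
        Ops.sumList SS (map (λ v → F SS.* term (suc (suc i)) v) (vecs n len))
          SSR.≈⟨ SumSS.sumList-map-*ˡ (vecs n len) F (term (suc (suc i))) ⟨
        F SS.* Ops.sumList SS (map (term (suc (suc i))) (vecs n len))
          SSR.≈⟨ SS.*-cong (factor-sum i) (term-sum (suc i) len) ⟩
        ExpS.exp (arg (suc i)) SS.* ExpS.exp (SumS.sum len (λ p → arg (suc (suc i) ℕ.+ p)))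
          SSR.≈⟨ agreeS (λ k _ → ExpS.exp-+ (arg (suc i)) (SumS.sum len (λ p → arg (suc (suc i) ℕ.+ p))) k) ⟩
        ExpS.exp (arg (suc i) S.+ SumS.sum len (λ p → arg (suc (suc i) ℕ.+ p)))
          SSR.≈⟨ agreeS (λ k _ → ExpS.exp-cong k (S.+-cong
                   (S.reflexive (≡.cong arg (≡.sym (ℕ.+-identityʳ (suc i)))))
                   (SumS.sum-cong len λ p _ → S.reflexive (≡.cong arg (≡.sym (ℕ.+-suc (suc i) p)))))) ⟩
        ExpS.exp (SumS.sum (suc len) (λ p → arg (suc i ℕ.+ p))) SSR.∎
        where
        module SSR = SetoidReasoning SS.setoid
        F = Ops.sumList SS (map (factor (suc i)) (upTo (suc n)))

        extend : ∀ v → Ops.sumList SS (map (term (suc i)) (map (_∷ v) (upTo (suc n)))) SS.≈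
                       F SS.* term (suc (suc i)) v
        extend v = SSR.begin
          Ops.sumList SS (map (term (suc i)) (map (_∷ v) (upTo (suc n))))
            SSR.≡⟨ ≡.cong (Ops.sumList SS) (map-∘ (upTo (suc n))) ⟨
          Ops.sumList SS (map (λ e → term (suc i) (e ∷ v)) (upTo (suc n)))
            SSR.≈⟨ SumSS.sumList-map-cong (upTo (suc n)) (λ e → term-∷ (suc i) e v) ⟩
          Ops.sumList SS (map (λ e → factor (suc i) e SS.* term (suc (suc i)) v) (upTo (suc n)))
            SSR.≈⟨ SumSS.sumList-map-*ʳ (upTo (suc n)) (term (suc (suc i)) v) (factor (suc i)) ⟨
          F SS.* term (suc (suc i)) v SSR.∎

      -- Modulo t^(n+1) the variables x_1, ..., x_n already determine all of x̂.
      sum-arg : SumS.sum n (λ p → arg (suc p)) S.≈ egf x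
      sum-arg = agree λ { zero _ → trans (reflexive (sum-Jets n n (arg ∘ suc) 0)) (sum-zero n λ _ _ → refl)
                        ; (suc m) m<n → trans (reflexive (sum-Jets n n (arg ∘ suc) (suc m)))
                                              (sum-mon n (λ p → x (suc p) * ifac (suc p)) m m<n) }

      -- `bellTerm` and the nested monomials branch on the same two decisions, so both sides reduce
      -- together; only the case where both hold needs an argument.
      bellTerm-term : ∀ v → bellTerm x n K v ≈ fromℕ (n !) * term 1 v K n
      bellTerm-term v with does (Σr v ℕ.≟ K)
      ... | false = sym (zeroʳ _)
      ... | true with does (Σir 1 v ℕ.≟ n) in eq
      ...   | true  = multinomial-weight n v (ℕ.≡ᵇ⇒≡ (Σir 1 v) n (≡.subst T (≡.sym eq) _))
      ...   | false = sym (zeroʳ _)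

      B-egf : B n K x ≈ fromℕ (n !) * (spow (egf x) K n * ifac K)
      B-egf = begin
        sumList (map (bellTerm x n K) (vecs n n))
          ≈⟨ sumList-map-cong (vecs n n) bellTerm-term ⟩
        sumList (map (λ v → fromℕ (n !) * term 1 v K n) (vecs n n))     ≈⟨ sumList-map-*ˡ (vecs n n) _ _ ⟨
        fromℕ (n !) * sumList (map (λ v → term 1 v K n) (vecs n n))     ≈⟨ *-congˡ coefficient ⟩
        fromℕ (n !) * (spow (egf x) K n * ifac K)                       ∎
        where
        coefficient : sumList (map (λ v → term 1 v K n) (vecs n n)) ≈ spow (egf x) K n * ifac K
        coefficient = begin
          sumList (map (λ v → term 1 v K n) (vecs n n))
            ≡⟨ sumList-Jets n (λ v → term 1 v K) (vecs n n) n ⟨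
          Ops.sumList S (map (λ v → term 1 v K) (vecs n n)) n
            ≡⟨ ≡.cong (λ f → f n) (ConvS.sumList-Jets K (term 1) (vecs n n) K) ⟨
          Ops.sumList SS (map (term 1) (vecs n n)) K n
            -- The coefficient of s^K t^n is the last one that both truncations retain.
            ≈⟨ _≋_.at (_≋S_.at (term-sum 0 n) K ℕ.≤-refl) n ℕ.≤-refl ⟩
          ExpS.exp (SumS.sum n (λ p → arg (suc p))) K n
            ≈⟨ _≋_.at (ExpS.exp-cong K sum-arg) n ℕ.≤-refl ⟩
          conv (Ops.pow S (egf x) K) (mon 0 (ifac K)) n
            ≈⟨ trans (conv-comm _ _ n) (trans (conv-constˡ (ifac K) _ n) (*-comm _ _)) ⟩
          Ops.pow S (egf x) K n * ifac K
            ≡⟨ ≡.cong (λ f → f n * ifac K) (pow-Jets n (egf x) K) ⟩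
          spow (egf x) K n * ifac K ∎

  B-< : ∀ x n k → n < k → B n k x ≈ 0#
  B-< x n k n<k = begin
    B n k x                                    ≈⟨ B-egf x n k ⟩
    fromℕ (n !) * (spow (egf x) k n * ifac k)
      ≈⟨ *-congˡ (trans (*-congʳ (spow-< (egf x) refl k n n<k)) (zeroˡ _)) ⟩
    fromℕ (n !) * 0#                           ≈⟨ zeroʳ _ ⟩
    0#                                         ∎

  B-diag : ∀ x n → B n n x ≈ pow (x 1) n
  B-diag x n = begin
    B n n x                                          ≈⟨ B-egf x n n ⟩
    fromℕ (n !) * (spow (egf x) n n * ifac n)
      ≈⟨ solve 3 (λ a b c → a :* (b :* c) := a :* c :* b) refl _ _ _ ⟩
    fromℕ (n !) * ifac n * spow (egf x) n n          ≈⟨ *-cong (ifac-inv n) (spow-diag (egf x) refl n) ⟩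
    1# * pow (x 1 * ifac 1) n                        ≈⟨ *-identityˡ _ ⟩
    pow (x 1 * ifac 1) n                             ≈⟨ pow-cong n (trans (*-congˡ ifac-1) (*-identityʳ _)) ⟩
    pow (x 1) n                                      ∎
    where
    ifac-1 : ifac 1 ≈ 1#
    ifac-1 = trans (sym (trans (*-congʳ fromℕ-1) (*-identityˡ _))) (ifac-inv 1)

  B-suc-0 : ∀ x n → B (suc n) 0 x ≈ 0#
  B-suc-0 x n = trans (B-egf x (suc n) 0) (trans (*-congˡ (zeroˡ _)) (zeroʳ _))

  -- Meant for the constant function 1, whose derivatives of positive order are all 0.
  B-vanish : ∀ x → (∀ j → x (suc j) ≈ 0#) → ∀ n k → B (suc n) k x ≈ 0#
  B-vanish x e n zero    = B-suc-0 x n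
  B-vanish x e n (suc k) = begin
    B (suc n) (suc k) x                                            ≈⟨ B-egf x (suc n) (suc k) ⟩
    fromℕ (suc n !) * (spow (egf x) (suc k) (suc n) * ifac (suc k))
      ≈⟨ *-congˡ (*-congʳ (trans (conv-congʳ (suc n) λ m _ → egf-zero m) (conv-zeroˡ (spow (egf x) k) (suc n)))) ⟩
    fromℕ (suc n !) * (0# * ifac (suc k))                          ≈⟨ trans (*-congˡ (zeroˡ _)) (zeroʳ _) ⟩
    0#                                                             ∎
    where
    egf-zero : ∀ m → egf x m ≈ 0#
    egf-zero zero    = refl
    egf-zero (suc m) = trans (*-congʳ (e m)) (zeroˡ _)

  module _ {φ f y : ℕ → Carrier} (y-comp : ∀ n → y (suc n) ≈ sumFT 1 (suc n) (λ k → B (suc n) k φ * f k)) where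

    -- The hypothesis `y-comp` is Faà di Bruno's formula for f̂ ∘ φ̂ at 0; division by n! restores
    -- plain composition of coefficients.
    egf-comp : ∀ n → egf y n ≈ (egf φ ⊙ egf f) n
    egf-comp zero    = sym (trans (+-identityʳ _) (zeroˡ _))
    egf-comp (suc n) = begin
      y N * ifac N                                     ≈⟨ *-congʳ (y-comp n) ⟩
      sumFT 1 N (λ k → B N k φ * f k) * ifac N         ≈⟨ *-congʳ (sumFT-sum 1 N (λ k → B N k φ * f k)) ⟩
      sum N (λ k → B N (suc k) φ * f (suc k)) * ifac N
        ≈⟨ sum-*ʳ N (ifac N) (λ k → B N (suc k) φ * f (suc k)) ⟩
      sum N (λ k → B N (suc k) φ * f (suc k) * ifac N) ≈⟨ sum-cong N (λ k _ → summand (suc k) (f (suc k))) ⟩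
      sum N (λ k → egf f (suc k) * spow (egf φ) (suc k) N) ≈⟨ +-identityˡ _ ⟨
      0# + sum N (λ k → egf f (suc k) * spow (egf φ) (suc k) N) ≈⟨ +-congʳ (zeroˡ _) ⟨
      (egf φ ⊙ egf f) N                                ∎
      where
      N = suc n
      summand : ∀ k a → B N k φ * a * ifac N ≈ a * ifac k * spow (egf φ) k N
      summand k a = begin
        B N k φ * a * ifac N
          ≈⟨ *-congʳ (*-congʳ (B-egf φ N k)) ⟩
        fromℕ (N !) * (spow (egf φ) k N * ifac k) * a * ifac N
          ≈⟨ solve 5 (λ m s i a j → m :* (s :* i) :* a :* j := m :* j :* (a :* i :* s)) refl _ _ _ _ _ ⟩
        fromℕ (N !) * ifac N * (a * ifac k * spow (egf φ) k N)
          ≈⟨ trans (*-congʳ (ifac-inv N)) (*-identityˡ _) ⟩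
        a * ifac k * spow (egf φ) k N ∎

    B-comp : ∀ n m → B n m y ≈ sum (suc n) (λ k → B n k φ * B k m f)
    B-comp n m = begin
      B n m y
        ≈⟨ B-egf y n m ⟩
      fromℕ (n !) * (spow (egf y) m n * ifac m)
        ≈⟨ *-congˡ (*-congʳ (trans (spow-cong egf-comp m n) (sym (⊙-spow (egf φ) refl (egf f) m n)))) ⟩
      fromℕ (n !) * ((egf φ ⊙ spow (egf f) m) n * ifac m)
        ≈⟨ trans (*-congˡ (sum-*ʳ (suc n) (ifac m) (λ k → spow (egf f) m k * spow (egf φ) k n)))
                 (sum-*ˡ (suc n) _ (λ k → spow (egf f) m k * spow (egf φ) k n * ifac m)) ⟩
      sum (suc n) (λ k → fromℕ (n !) * (spow (egf f) m k * spow (egf φ) k n * ifac m))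
        ≈⟨ sum-cong (suc n) (λ k _ → summand k) ⟩
      sum (suc n) (λ k → B n k φ * B k m f) ∎
      where
      -- The 1/k! in B_{n,k}(φ) cancels the k! in B_{k,m}(f), which is why the Bell matrices
      -- multiply without extra factors.
      summand : ∀ k → fromℕ (n !) * (spow (egf f) m k * spow (egf φ) k n * ifac m) ≈ B n k φ * B k m f
      summand k = sym (begin
        B n k φ * B k m f
          ≈⟨ *-cong (B-egf φ n k) (B-egf f k m) ⟩
        fromℕ (n !) * (spow (egf φ) k n * ifac k) * (fromℕ (k !) * (spow (egf f) m k * ifac m))
          ≈⟨ solve 6 (λ a s i b r j → a :* (s :* i) :* (b :* (r :* j)) := b :* i :* (a :* (r :* s :* j))) refl _ _ _ _ _ _ ⟩
        fromℕ (k !) * ifac k * (fromℕ (n !) * (spow (egf f) m k * spow (egf φ) k n * ifac m))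
          ≈⟨ trans (*-congʳ (ifac-inv k)) (*-identityˡ _) ⟩
        fromℕ (n !) * (spow (egf f) m k * spow (egf φ) k n * ifac m) ∎)

-- The family A as inverse of the Bell matrix.

if-≡ : ∀ {a} {V : Set a} {m n : ℕ} {x y : V} → m ≡ n → (if does (m ℕ.≟ n) then x else y) ≡ x
if-≡ {m = m} {n} {x} {y} p = ≡.cong (if_then x else y) (dec-true (m ℕ.≟ n) p)

if-≢ : ∀ {a} {V : Set a} {m n : ℕ} {x y : V} → m ≢ n → (if does (m ℕ.≟ n) then x else y) ≡ y
if-≢ {m = m} {n} {x} {y} p = ≡.cong (if_then x else y) (dec-false (m ℕ.≟ n) p)

module Inversion {c ℓ : Level} (R : CommutativeRing c ℓ)
  (ifac : ℕ → CommutativeRing.Carrier R) (ifac-inv : Sums.IsInverseFactorial R ifac) where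

  open CommutativeRing R
  open Ops R
  open Sums R
  open Convolution R
  open Bell R ifac ifac-inv
  open SetoidReasoning setoid
  open NatSolver commutativeSemiring using (solve; _:+_; _:*_; _:=_; con)

  module _ (x : ℕ → Carrier) (u : Carrier) where

    -- Each further unit of fuel fills one column, further to the left than all columns filled
    -- before. The bound `h + g ≤ n` keeps the truncated differences strictly decreasing.
    rowUpTo-stable : ∀ n g h k → n ∸ g ≤ k → h ℕ.+ g ≤ n → rowUpTo x u n (h ℕ.+ g) k ≡ rowUpTo x u n g k
    rowUpTo-stable n g zero    k p q = ≡.refl
    rowUpTo-stable n g (suc h) k p q = ≡.trans
      (if-≢ {m = k} {n ∸ suc (h ℕ.+ g)} λ k≡ → ℕ.<⇒≢ (ℕ.<-≤-trans (below n (h ℕ.+ g) q) bound) (≡.sym k≡))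
      (rowUpTo-stable n g h k p (ℕ.<⇒≤ q))
      where
      below : ∀ n m → suc m ≤ n → n ∸ suc m < n ∸ m
      below n m m<n = ℕ.∸-monoʳ-< ℕ.≤-refl m<n
      bound : n ∸ (h ℕ.+ g) ≤ k
      bound = ℕ.≤-trans (ℕ.∸-monoʳ-≤ n (ℕ.m≤n+m g h)) p

    A-diag : ∀ n → A n n x u ≈ pow u n
    A-diag zero    = refl
    A-diag (suc n) = reflexive (≡.trans
      (≡.trans (≡.cong (λ g → rowUpTo x u (suc n) g (suc n)) (≡.sym (ℕ.+-identityʳ (suc n))))
               (rowUpTo-stable (suc n) 0 (suc n) (suc n) ℕ.≤-refl (ℕ.≤-reflexive (ℕ.+-identityʳ (suc n)))))
      (if-≡ {m = suc n} ≡.refl))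

    A-> : ∀ n k → n < k → A n k x u ≈ 0#
    A-> n (suc k) n<k = reflexive (go n)
      where
      go : ∀ g → rowUpTo x u n g (suc k) ≡ 0#
      go zero    = if-≢ (ℕ.>⇒≢ n<k)
      go (suc g) = ≡.trans (if-≢ (ℕ.>⇒≢ (ℕ.≤-<-trans (ℕ.m∸n≤m n (suc g)) n<k))) (go g)

    -- `n` is written as a sum so that the fuel `suc g`, with which column `suc k` gets filled, is
    -- visible.
    A-rec : ∀ k g → let n = suc k ℕ.+ suc g in
      A n (suc k) x u ≈ - (pow u (suc k) * sumFT (suc (suc k)) n (λ j → A n j x u * B j (suc k) x))
    A-rec k g = begin
      rowUpTo x u n (suc k ℕ.+ suc g) (suc k)
        ≡⟨ rowUpTo-stable n (suc g) (suc k) (suc k) (ℕ.≤-reflexive n∸g) ℕ.≤-refl ⟩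
      rowUpTo x u n (suc g) (suc k)
        ≡⟨ if-≡ {m = suc k} {n ∸ suc g} (≡.sym n∸g) ⟩
      - (pow u (suc k) * sumFT (suc (suc k)) n (λ j → rowUpTo x u n g j * B j (suc k) x))
        ≈⟨ -‿cong (*-congˡ (sumFT-cong (suc (suc k)) n λ j k<j _ → *-congʳ {B j (suc k) x} (later j k<j))) ⟩
      - (pow u (suc k) * sumFT (suc (suc k)) n (λ j → A n j x u * B j (suc k) x)) ∎
      where
      n = suc k ℕ.+ suc g
      n∸g : n ∸ suc g ≡ suc k
      n∸g = ℕ.m+n∸n≡m (suc k) (suc g)
      n≡ : suc (suc k) ℕ.+ g ≡ n
      n≡ = ≡.sym (ℕ.+-suc (suc k) g)
      -- Fuel `g` already covers all columns beyond `suc k`, so their entries are final.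
      later : ∀ j → suc (suc k) ≤ j → rowUpTo x u n g j ≈ A n j x u
      later (suc j) k<j = reflexive (≡.sym (≡.trans
        (≡.cong (λ h → rowUpTo x u n h (suc j)) (≡.sym n≡))
        (rowUpTo-stable n g (suc (suc k)) (suc j)
          (≡.subst (_≤ suc j) (≡.sym (≡.trans (≡.cong (_∸ g) (≡.sym n≡)) (ℕ.m+n∸n≡m (suc (suc k)) g))) k<j)
          (ℕ.≤-reflexive n≡))))

    module _ (inverse : x 1 * u ≈ 1#) where

      B-diag-inverse : ∀ k → B k k x * pow u k ≈ 1#
      B-diag-inverse k = begin
        B k k x * pow u k       ≈⟨ *-congʳ (B-diag x k) ⟩
        pow (x 1) k * pow u k   ≈⟨ pow-* (x 1) u k ⟨
        pow (x 1 * u) k         ≈⟨ trans (pow-cong k inverse) (pow-1 k) ⟩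
        1#                      ∎

      -- For 1 ≤ k < n the recursion for A is this equation solved for A_{n,k}: multiplying it by
      -- B_{k,k}, whose inverse is u^k, gives the equation back.
      A-B-inverse : ∀ n k → sum (suc n) (λ j → A n j x u * B j k x) ≈ mon n 1# k
      A-B-inverse n zero = begin
        A n 0 x u * B 0 0 x + sum n (λ j → A n (suc j) x u * B (suc j) 0 x)
          ≈⟨ +-cong (*-congˡ (B-diag x 0)) (sum-zero n λ j _ → trans (*-congˡ (B-suc-0 x j)) (zeroʳ _)) ⟩
        A n 0 x u * 1# + 0#
          ≈⟨ trans (+-identityʳ _) (*-identityʳ _) ⟩
        -- Column 0 of A and `mon n 1# 0` are the same conditional.
        A n 0 x u ∎
      A-B-inverse n k@(suc k′) with ℕ.<-cmp k n
      ... | tri> _ _ n<k = trans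
        (sum-zero (suc n) λ j j≤n → trans (*-congˡ {A n j x u} (B-< x j k (ℕ.≤-trans j≤n n<k))) (zeroʳ _))
        (sym (mon-> n<k))
      ... | tri≈ _ ≡.refl _ = begin
        sum (suc k) (λ j → A k j x u * B j k x)      ≈⟨ sum-last k (λ j → A k j x u * B j k x) ⟩
        sum k (λ j → A k j x u * B j k x) + A k k x u * B k k x
          ≈⟨ +-cong (sum-zero k λ j j<k → trans (*-congˡ {A k j x u} (B-< x j k j<k)) (zeroʳ _))
                    (trans (*-congʳ (A-diag k)) (trans (*-comm _ _) (B-diag-inverse k))) ⟩
        0# + 1#                                      ≈⟨ +-identityˡ 1# ⟩
        1#                                           ≈⟨ mon-diag k ⟨
        mon k 1# k                                   ∎
      ... | tri< k<n _ _ = begin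
        sum (suc n) f
          ≈⟨ sumFT-full k n f (λ j j<k → trans (*-congˡ {A n j x u} (B-< x j k j<k)) (zeroʳ _)) ⟨
        sumFT k n f                                  ≈⟨ sumFT-head f (ℕ.<⇒≤ k<n) ⟩
        A n k x u * B k k x + rest                   ≈⟨ +-congʳ (*-congʳ (rec (n ∸ suc k) n≡)) ⟩
        - (pow u k * rest) * B k k x + rest          ≈⟨ +-congʳ (sym (-‿distribˡ-* _ _)) ⟩
        - (pow u k * rest * B k k x) + rest
          ≈⟨ +-congʳ (-‿cong (solve 3 (λ a b c → a :* b :* c := c :* a :* b) refl _ _ _)) ⟩
        - (B k k x * pow u k * rest) + rest
          ≈⟨ +-congʳ (-‿cong (trans (*-congʳ (B-diag-inverse k)) (*-identityˡ _))) ⟩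
        - rest + rest                                ≈⟨ -‿inverseˡ rest ⟩
        0#                                           ≈⟨ mon-< k<n ⟨
        mon n 1# k                                   ∎
        where
        open RingProperties ring using (-‿distribˡ-*)
        f = λ j → A n j x u * B j k x
        rest = sumFT (suc k) n f
        n≡ : suc k′ ℕ.+ suc (n ∸ suc k) ≡ n
        n≡ = ≡.trans (ℕ.+-suc k (n ∸ suc k)) (ℕ.m+[n∸m]≡n k<n)
        -- With `g` a variable, matching on the equation turns `n` into the sum for which `A-rec` is
        -- stated.
        rec : ∀ g → suc k′ ℕ.+ suc g ≡ n → A n k x u ≈ - (pow u k * rest)
        rec g ≡.refl = A-rec k′ g

      -- Among rows 0 to n, column n of the Bell matrix has only its diagonal entry, a unit.
      B-cancel-top : ∀ n (a b : ℕ → Carrier) →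
        sum (suc n) (λ j → a j * B j n x) ≈ sum (suc n) (λ j → b j * B j n x) → a n ≈ b n
      B-cancel-top n a b e = trans (sym (top a)) (trans (*-congʳ e) (top b))
        where
        top : ∀ (a : ℕ → Carrier) → sum (suc n) (λ j → a j * B j n x) * pow u n ≈ a n
        top a = begin
          sum (suc n) (λ j → a j * B j n x) * pow u n
            ≈⟨ *-congʳ (sum-last n (λ j → a j * B j n x)) ⟩
          (sum n (λ j → a j * B j n x) + a n * B n n x) * pow u n
            ≈⟨ *-congʳ (trans (+-congʳ (sum-zero n λ j j<n → trans (*-congˡ {a j} (B-< x j n j<n)) (zeroʳ _))) (+-identityˡ _)) ⟩
          a n * B n n x * pow u n
            ≈⟨ trans (*-assoc _ _ _) (trans (*-congˡ (B-diag-inverse n)) (*-identityʳ _)) ⟩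
          a n ∎

      -- Back substitution: the last column fixes the last entry, whose contribution is then removed
      -- from the other columns.
      B-cancelʳ : ∀ N (a b : ℕ → Carrier) →
        (∀ k → k < N → sum N (λ j → a j * B j k x) ≈ sum N (λ j → b j * B j k x)) →
        ∀ k → k < N → a k ≈ b k
      B-cancelʳ (suc n) a b e k k<N with ℕ.m≤n⇒m<n∨m≡n (ℕ.≤-pred k<N)
      ... | inj₂ ≡.refl = B-cancel-top n a b (e n ℕ.≤-refl)
      ... | inj₁ k<n = B-cancelʳ n a b (λ m m<n → ∙-cancelʳ (a n * B n m x) _ _ (begin
        sum n (λ j → a j * B j m x) + a n * B n m x ≈⟨ sum-last n (λ j → a j * B j m x) ⟨
        sum (suc n) (λ j → a j * B j m x)           ≈⟨ e m (ℕ.m≤n⇒m≤1+n m<n) ⟩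
        sum (suc n) (λ j → b j * B j m x)           ≈⟨ sum-last n (λ j → b j * B j m x) ⟩
        sum n (λ j → b j * B j m x) + b n * B n m x ≈⟨ +-congˡ (*-congʳ (B-cancel-top n a b (e n ℕ.≤-refl))) ⟨
        sum n (λ j → b j * B j m x) + a n * B n m x ∎)) k k<n
        where open GroupProperties +-group using (∙-cancelʳ)

  -- Both sides invert B(y) = B(φ) B(f) from the left.
  A-comp : ∀ {φ f y : ℕ → Carrier} {v u w : Carrier} → φ 1 * v ≈ 1# → f 1 * u ≈ 1# → y 1 * w ≈ 1# →
    (∀ n → y (suc n) ≈ sumFT 1 (suc n) (λ k → B (suc n) k φ * f k)) →
    ∀ n k → k ≤ n → A n k y w ≈ sum (suc n) (λ j → A n j f u * A j k φ v)
  A-comp {φ} {f} {y} {v} {u} {w} φ-inv f-inv y-inv y-comp n k k≤n =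
    B-cancelʳ y w y-inv N (λ k → A n k y w) (λ k → sum N (λ j → A n j f u * A j k φ v))
      (λ m _ → trans (A-B-inverse y w y-inv n m) (sym (product m))) k (s≤s k≤n)
    where
    -- All matrices are cut to the common size n + 1; by triangularity, products of the cut matrices
    -- agree with those of the infinite ones.
    N = suc n

    AφBφ : ∀ j l → j < N → sum N (λ k → A j k φ v * B k l φ) ≈ mon j 1# l
    AφBφ j l j<N = trans
      (sym (sum-extend (suc j) N j<N λ k j<k → trans (*-congʳ {B k l φ} (A-> φ v j k j<k)) (zeroˡ _)))
      (A-B-inverse φ v φ-inv j l)

    By : ∀ k m → k < N → B k m y ≈ sum N (λ l → B k l φ * B l m f)
    By k m k<N = trans (B-comp y-comp k m)
      (sum-extend (suc k) N k<N λ l k<l → trans (*-congʳ {B l m f} (B-< φ k l k<l)) (zeroˡ _))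

    Aφ-By : ∀ j m → j < N → sum N (λ k → A j k φ v * B k m y) ≈ B j m f
    Aφ-By j m j<N = begin
      sum N (λ k → A j k φ v * B k m y)
        ≈⟨ sum-cong N (λ k k<N → *-congˡ {A j k φ v} (By k m k<N)) ⟩
      sum N (λ k → A j k φ v * sum N (λ l → B k l φ * B l m f))
        ≈⟨ row-matrix-column N (λ k → A j k φ v) (λ k l → B k l φ) (λ l → B l m f) ⟨
      sum N (λ l → sum N (λ k → A j k φ v * B k l φ) * B l m f)
        ≈⟨ sum-cong N (λ l _ → *-congʳ {B l m f} (AφBφ j l j<N)) ⟩
      sum N (λ l → mon j 1# l * B l m f)
        ≈⟨ sum-δ N j (λ l → B l m f) j<N ⟩
      B j m f ∎

    product : ∀ m → sum N (λ k → sum N (λ j → A n j f u * A j k φ v) * B k m y) ≈ mon n 1# m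
    product m = begin
      sum N (λ k → sum N (λ j → A n j f u * A j k φ v) * B k m y)
        ≈⟨ row-matrix-column N (λ j → A n j f u) (λ j k → A j k φ v) (λ k → B k m y) ⟩
      sum N (λ j → A n j f u * sum N (λ k → A j k φ v * B k m y))
        ≈⟨ sum-cong N (λ j j<N → *-congˡ {A n j f u} (Aφ-By j m j<N)) ⟩
      sum N (λ j → A n j f u * B j m f)
        ≈⟨ A-B-inverse f u f-inv n m ⟩
      mon n 1# m ∎

-- The coefficients of Γ and Γ̄ for the constant weight 1.

module UnitWeight {c ℓ : Level} (K : Field c ℓ) (charZero : FieldOps.CharZero K) where
  open Field K
  open FieldOps K

  -- Characteristic zero enters here: the nonzero natural number n! stays nonzero in `K`.
  ifac : ℕ → Carrier
  ifac n = inv (fromℕ (n !)) λ e → ℕ.≢-nonZero⁻¹ (n !) {{n ℕ.!≢0}} (charZero (n !) e)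

  ifac-inv : ∀ n → fromℕ (n !) * ifac n ≈ 1#
  ifac-inv n = inverse (fromℕ (n !)) _

  open Sums commutativeRing
  open Bell commutativeRing ifac ifac-inv
  open Inversion commutativeRing ifac ifac-inv
  open SetoidReasoning setoid

  d-oneS : ∀ j → d oneS (suc j) ≈ 0#
  d-oneS j = trans (*-congˡ (tail j 0)) (zeroʳ _)
    where
    tail : ∀ j n → Dpow j oneS (suc n) ≈ 0#
    tail zero    n = refl
    tail (suc j) n = trans (*-congˡ (tail j (suc n))) (zeroʳ _)

  -- The positive derivatives of 1 vanish, so only the summand j = n survives, with binomial
  -- coefficient 1.
  γcoef-one : ∀ φ n k → γcoef oneS φ n k ≈ Bφ φ n k
  γcoef-one φ n k = begin
    sumFT k n f         ≈⟨ sumFT-full k n f (λ j j<k → trans (*-congˡ (B-< (d φ) j k j<k)) (zeroʳ _)) ⟩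
    sum (suc n) f       ≈⟨ sum-last n f ⟩
    sum n f + f n
      ≈⟨ +-cong (sum-zero n λ j j<n → trans (*-congʳ (trans (*-congˡ (lower j<n)) (zeroʳ _))) (zeroˡ _)) last ⟩
    0# + Bφ φ n k       ≈⟨ +-identityˡ _ ⟩
    Bφ φ n k            ∎
    where
    f = λ j → fromℕ (n C j) * d oneS (n ∸ j) * Bφ φ j k
    positive : ∀ {m} → 0 < m → d oneS m ≈ 0#
    positive {suc m} _ = d-oneS m
    lower : ∀ {j} → j < n → d oneS (n ∸ j) ≈ 0#
    lower j<n = positive (ℕ.m<n⇒0<n∸m j<n)
    last : f n ≈ Bφ φ n k
    last = begin
      fromℕ (n C n) * d oneS (n ∸ n) * Bφ φ n k
        ≡⟨ ≡.cong₂ (λ a b → fromℕ a * d oneS b * Bφ φ n k) (nCn≡1 n) (ℕ.n∸n≡0 n) ⟩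
      fromℕ 1 * 1# * Bφ φ n k                   ≈⟨ *-congʳ (trans (*-identityʳ _) fromℕ-1) ⟩
      1# * Bφ φ n k                             ≈⟨ *-identityˡ _ ⟩
      Bφ φ n k                                  ∎

  Rhat-one-0 : Rhat 0 (d oneS) (inv 1# 1≉0) ≈ 1#
  Rhat-one-0 = begin
    1# * fromℕ 1 * (inv 1# 1≉0 * 1#) * B 0 0 (d oneS) + 0# ≈⟨ +-identityʳ _ ⟩
    1# * fromℕ 1 * (inv 1# 1≉0 * 1#) * B 0 0 (d oneS)      ≈⟨ *-cong (*-cong (trans (*-identityˡ _) fromℕ-1)
                                                                 (trans (*-comm _ _) (inverse 1# 1≉0))) (B-diag (d oneS) 0) ⟩
    1# * 1# * 1#                                           ≈⟨ trans (*-identityʳ _) (*-identityʳ _) ⟩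
    1#                                                     ∎

  -- `Rhat m` gives the m-th derivative of 1/a at 0, and here a = 1.
  Rhat-one-suc : ∀ m w → Rhat (suc m) (d oneS) w ≈ 0#
  Rhat-one-suc m w = sumFT-zero 0 (suc m) λ i _ _ →
    trans (*-congˡ (B-vanish (d oneS) d-oneS m i)) (zeroʳ _)

  -- Only the summand j = k survives; `k ≤ n` places it inside the range of summation.
  γbarcoef-one : ∀ ψ hψ n k → k ≤ n → γbarcoef oneS (inv 1# 1≉0) ψ hψ n k ≈ Aφ ψ hψ n k
  γbarcoef-one ψ hψ n k k≤n = begin
    sumFT k n f             ≈⟨ sumFT-head f k≤n ⟩
    f k + sumFT (suc k) n f ≈⟨ +-cong first (sumFT-zero (suc k) n λ j k<j _ →
                                 trans (*-congʳ {Aφ ψ hψ n j} (trans (*-congˡ {fromℕ (j C k)} (positive (ℕ.m<n⇒0<n∸m k<j))) (zeroʳ _))) (zeroˡ _)) ⟩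
    Aφ ψ hψ n k + 0#        ≈⟨ +-identityʳ _ ⟩
    Aφ ψ hψ n k             ∎
    where
    ρ : ℕ → Carrier
    ρ m = Rhat m (d oneS) (inv 1# 1≉0)
    f = λ j → fromℕ (j C k) * ρ (j ∸ k) * Aφ ψ hψ n j
    positive : ∀ {m} → 0 < m → ρ m ≈ 0#
    positive {suc m} _ = Rhat-one-suc m (inv 1# 1≉0)
    first : f k ≈ Aφ ψ hψ n k
    first = begin
      fromℕ (k C k) * ρ (k ∸ k) * Aφ ψ hψ n k
        ≡⟨ ≡.cong₂ (λ a b → fromℕ a * ρ b * Aφ ψ hψ n k) (nCn≡1 k) (ℕ.n∸n≡0 k) ⟩
      fromℕ 1 * ρ 0 * Aφ ψ hψ n k             ≈⟨ *-congʳ (*-cong fromℕ-1 Rhat-one-0) ⟩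
      1# * 1# * Aφ ψ hψ n k                   ≈⟨ trans (*-congʳ (*-identityˡ 1#)) (*-identityˡ _) ⟩
      Aφ ψ hψ n k                             ∎

-- Transport from the field to the algebra, and the final identity.

module BaseChange {c ℓ c′ ℓ′ : Level} (K : Field c ℓ) (charZero : FieldOps.CharZero K)
  (R : CommutativeRing c′ ℓ′) (ι : Field.Carrier K → CommutativeRing.Carrier R) (hom : IsRingHom K R ι) where

  open UnitWeight K charZero using (ifac; ifac-inv; γcoef-one; γbarcoef-one)
  open RingMorphisms.IsRingHomomorphism hom
  open CommutativeRing R
  open Ops R
  open SetoidReasoning setoid
  open Sums R
  open Convolution R
  open Composition R
  private
    module K where
      open Field K public
      open Ops commutativeRing public
      open Sums commutativeRing public
      open Convolution commutativeRing public
      open Bell commutativeRing ifac ifac-inv public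

  ι-fromℕ : ∀ n → ι (K.fromℕ n) ≈ fromℕ n
  ι-fromℕ zero    = 0#-homo
  ι-fromℕ (suc n) = trans (+-homo _ _) (+-cong 1#-homo (ι-fromℕ n))

  ι-pow : ∀ a n → ι (K.pow a n) ≈ pow (ι a) n
  ι-pow a zero    = 1#-homo
  ι-pow a (suc n) = trans (*-homo _ _) (*-congˡ (ι-pow a n))

  ι-sumFT : ∀ a b (f : ℕ → K.Carrier) → ι (K.sumFT a b f) ≈ sumFT a b (ι ∘ f)
  ι-sumFT a b f = go (upTo (suc b ∸ a))
    where
    go : ∀ is → ι (foldr (λ i s → f (a ℕ.+ i) K.+ s) K.0# is) ≈ foldr (λ i s → ι (f (a ℕ.+ i)) + s) 0# is
    go []       = 0#-homo
    go (i ∷ is) = trans (+-homo _ _) (+-congˡ (go is))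

  ιfac : ℕ → Carrier
  ιfac n = ι (ifac n)

  ιfac-inv : ∀ n → fromℕ (n !) * ιfac n ≈ 1#
  ιfac-inv n = begin
    fromℕ (n !) * ιfac n           ≈⟨ *-congʳ (ι-fromℕ (n !)) ⟨
    ι (K.fromℕ (n !)) * ι (ifac n) ≈⟨ *-homo _ _ ⟨
    ι (K.fromℕ (n !) K.* ifac n)   ≈⟨ ⟦⟧-cong (ifac-inv n) ⟩
    ι K.1#                         ≈⟨ 1#-homo ⟩
    1#                             ∎

  open Bell R ιfac ιfac-inv
  open Inversion R ιfac ιfac-inv

  ι-conv : ∀ f g n → ι (K.conv f g n) ≈ conv (ι ∘ f) (ι ∘ g) n
  ι-conv f g zero    = *-homo _ _
  ι-conv f g (suc n) = trans (+-homo _ _) (+-cong (*-homo _ _) (ι-conv (f ∘ suc) g n))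

  ι-spow : ∀ f k n → ι (K.spow f k n) ≈ spow (ι ∘ f) k n
  ι-spow f zero    zero    = 1#-homo
  ι-spow f zero    (suc n) = 0#-homo
  ι-spow f (suc k) n       = trans (ι-conv f (K.spow f k) n) (conv-congˡ n λ m _ → ι-spow f k m)

  ι-egf : ∀ x n → ι (K.egf x n) ≈ egf (ι ∘ x) n
  ι-egf x zero    = 0#-homo
  ι-egf x (suc n) = *-homo _ _

  -- Going through `B-egf` on both sides avoids pushing ι through the enumeration of exponent
  -- vectors and its integer quotients.
  ι-B : ∀ n k x → ι (K.B n k x) ≈ B n k (ι ∘ x)
  ι-B n k x = begin
    ι (K.B n k x)                                                 ≈⟨ ⟦⟧-cong (K.B-egf x n k) ⟩
    ι (K.fromℕ (n !) K.* (K.spow (K.egf x) k n K.* ifac k))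
      ≈⟨ trans (*-homo _ _) (*-cong (ι-fromℕ (n !)) (*-homo _ _)) ⟩
    fromℕ (n !) * (ι (K.spow (K.egf x) k n) * ιfac k)
      ≈⟨ *-congˡ (*-congʳ (trans (ι-spow (K.egf x) k n)
                                                                       (spow-cong (ι-egf x) k n))) ⟩
    fromℕ (n !) * (spow (egf (ι ∘ x)) k n * ιfac k)               ≈⟨ B-egf (ι ∘ x) n k ⟨
    B n k (ι ∘ x)                                                 ∎

  ι-rowUpTo : ∀ x u n g k → ι (K.rowUpTo x u n g k) ≈ rowUpTo (ι ∘ x) (ι u) n g k
  ι-rowUpTo x u n zero    k with does (k ℕ.≟ n)
  ... | true  = ι-pow u n
  ... | false = 0#-homo
  ι-rowUpTo x u n (suc g) k with does (k ℕ.≟ n ∸ suc g)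
  ... | false = ι-rowUpTo x u n g k
  ... | true  = begin
    ι (K.- (K.pow u k K.* K.sumFT (suc k) n f))     ≈⟨ trans (-‿homo _) (-‿cong (*-homo _ _)) ⟩
    - (ι (K.pow u k) * ι (K.sumFT (suc k) n f))     ≈⟨ -‿cong (*-cong (ι-pow u k) (ι-sumFT (suc k) n f)) ⟩
    - (pow (ι u) k * sumFT (suc k) n (ι ∘ f))       ≈⟨ -‿cong (*-congˡ (sumFT-cong (suc k) n λ j _ _ →
                                                         trans (*-homo _ _) (*-cong (ι-rowUpTo x u n g j) (ι-B j k x)))) ⟩
    - (pow (ι u) k * sumFT (suc k) n (λ j → rowUpTo (ι ∘ x) (ι u) n g j * B j k (ι ∘ x))) ∎
    where f = λ j → K.rowUpTo x u n g j K.* K.B j k x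

  ι-A : ∀ n k x u → ι (K.A n k x u) ≈ A n k (ι ∘ x) (ι u)
  ι-A zero    zero    x u = 1#-homo
  ι-A (suc n) zero    x u = 0#-homo
  ι-A n       (suc k) x u = ι-rowUpTo x u n n (suc k)

  module _ (X : ℕ → Carrier) (u : Carrier) (X₁u : X 1 * u ≈ 1#) where
    open FieldOps K using (Series; InFstar; Aφ; d; oneS)
    open AlgOps K R ι
    open NatSolver commutativeSemiring using (solve; _:+_; _:*_; _:=_; con)

    module _ (φ : Series) (hφ : InFstar φ) where
      private v = K.inv (d φ 1) (InFstar.der0 hφ)

      -- Puts Γ(1, φ) into the form of Faà di Bruno's formula that `A-comp` expects.
      Γ-one : ∀ n → Γ oneS φ X n ≈ sumFT 1 n (λ k → B n k (ι ∘ d φ) * X k)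
      Γ-one n = sumFT-cong 1 n λ k _ _ → *-congʳ {X k} (trans (⟦⟧-cong (γcoef-one φ n k)) (ι-B n k (d φ)))

      dφ₁-inverse : ι (d φ 1) * ι v ≈ 1#
      dφ₁-inverse = trans (sym (*-homo _ _)) (trans (⟦⟧-cong (K.inverse (d φ 1) (InFstar.der0 hφ))) 1#-homo)

      Γ₁-inverse : Γ oneS φ X 1 * Γ₁inv φ hφ u ≈ 1#
      Γ₁-inverse = begin
        Γ oneS φ X 1 * (ι v * u)             ≈⟨ *-congʳ (trans (Γ-one 1) (+-identityʳ _)) ⟩
        B 1 1 (ι ∘ d φ) * X 1 * (ι v * u)
          ≈⟨ *-congʳ (*-congʳ (trans (B-diag (ι ∘ d φ) 1) (*-identityʳ _))) ⟩
        ι (d φ 1) * X 1 * (ι v * u)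
          ≈⟨ solve 4 (λ a b c e → a :* b :* (c :* e) := a :* c :* (b :* e)) refl _ _ _ _ ⟩
        ι (d φ 1) * ι v * (X 1 * u)          ≈⟨ *-cong dφ₁-inverse X₁u ⟩
        1# * 1#                              ≈⟨ *-identityˡ 1# ⟩
        1#                                   ∎

      A-Γ : ∀ k → 1 ≤ k → A k 1 (Γ oneS φ X) (Γ₁inv φ hφ u) ≈ sumFT 1 k (λ j → ι (Aφ φ hφ j 1) * A k j X u)
      A-Γ k@(suc _) 1≤k = begin
        A k 1 (Γ oneS φ X) (Γ₁inv φ hφ u)
          ≈⟨ A-comp dφ₁-inverse X₁u Γ₁-inverse (λ n → Γ-one (suc n)) k 1 1≤k ⟩
        sum (suc k) (λ j → A k j X u * A j 1 (ι ∘ d φ) (ι v))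
          -- The summand j = 0 drops out because A_{k,0} = 0 for k ≥ 1.
          ≈⟨ sumFT-full 1 k (λ j → A k j X u * A j 1 (ι ∘ d φ) (ι v)) (λ { zero _ → zeroˡ _ ; (suc _) (s≤s ()) }) ⟨
        sumFT 1 k (λ j → A k j X u * A j 1 (ι ∘ d φ) (ι v))
          ≈⟨ sumFT-cong 1 k (λ j _ _ → trans (*-congˡ {A k j X u} (sym (ι-A j 1 (d φ) v))) (*-comm _ _)) ⟩
        sumFT 1 k (λ j → ι (Aφ φ hφ j 1) * A k j X u) ∎

    Λ≈RHS : ∀ φ hφ ψ hψ n → Λ φ hφ ψ hψ X u n ≈ RHS φ hφ ψ hψ X u n
    Λ≈RHS φ hφ ψ hψ n = begin
      sumFT 0 n f   ≈⟨ sumFT-head {n = n} f z≤n ⟩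
      -- The summand k = 0 contains `A 0 1`, which computes to `0#` in agreement with the convention
      -- A_{0,1} = 0.
      f 0 + sumFT 1 n f ≈⟨ trans (+-congʳ (zeroʳ _)) (+-identityˡ _) ⟩
      sumFT 1 n f
        ≈⟨ sumFT-cong 1 n (λ k 1≤k k≤n → *-cong (⟦⟧-cong (γbarcoef-one ψ hψ n k k≤n)) (A-Γ φ hφ k 1≤k)) ⟩
      RHS φ hφ ψ hψ X u n ∎
      where
      f = λ k → ι (FieldOps.γbarcoef K oneS (K.inv K.1# K.1≉0) ψ hψ n k) * A k 1 (Γ oneS φ X) (Γ₁inv φ hφ u)

theorem7p10 : ∀ {c ℓ c' ℓ' : Level} (K : Field c ℓ) → FieldOps.CharZero K →
    (R : CommutativeRing c' ℓ') (ι : Field.Carrier K → CommutativeRing.Carrier R) →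
    IsRingHom K R ι →
    (X : ℕ → CommutativeRing.Carrier R) (u : CommutativeRing.Carrier R) →
    CommutativeRing._≈_ R (CommutativeRing._*_ R (X 1) u) (CommutativeRing.1# R) →
    (φ ψ : FieldOps.Series K) (hφ : FieldOps.InFstar K φ) (hψ : FieldOps.InFstar K ψ) →
    (n : ℕ) → n ≥ 1 →
    CommutativeRing._≈_ R (AlgOps.Λ K R ι φ hφ ψ hψ X u n) (AlgOps.RHS K R ι φ hφ ψ hψ X u n)
theorem7p10 K charZero R ι hom X u X₁u φ ψ hφ hψ n _ =
  BaseChange.Λ≈RHS K charZero R ι hom X u X₁u φ hφ ψ hψ n
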